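{- For $m\ge0$ let $p_m(x)=1+\sum_{i=1}^m (ix)^i$. Then $p_m$ has no real root if $m$ is even and exactly one real root (counted with multiplicity) if $m$ is odd. -}

module Defs where

open import Algebra.Bundles using (RawSemiring; CommutativeRing)
import Algebra.Definitions.RawSemiring as RawSemiringDefs
open import Data.List.Base using (List; []; _∷_; map; foldr)
open import Data.Nat.Base as ℕ using (ℕ; zero; suc; _⊔_)
import Data.Nat.Properties as ℕ
open import Data.Product.Base using (Σ-syntax; ∃-syntax; _×_; _,_)
open import Data.Rational.Base as ℚ using (ℚ; 0ℚ; 1ℚ; ½; ∣_∣; Positive; NonZero; 1/_)
import Data.Rational.Properties as ℚ
open import Data.Rational.Solver using (module +-*-Solver)
open import Level using (0ℓ) renaming (_⊔_ to _⊔ˡ_)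
open import Relation.Binary.PropositionalEquality using (_≡_; refl; sym; trans; cong; cong₂; subst)

-- Reals are Cauchy sequences of rationals, identified (by _≃_) when their
-- difference is a null sequence.

Eventually : (ℕ → Set) → Set
Eventually P = ∃[ N ] ∀ n → N ℕ.≤ n → P n

IsCauchy : (ℕ → ℚ) → Set
IsCauchy s = ∀ ε → 0ℚ ℚ.< ε →
  ∃[ N ] ∀ m n → N ℕ.≤ m → N ℕ.≤ n → ∣ s m ℚ.- s n ∣ ℚ.< ε

record ℝ : Set where
  constructor mkℝ
  field
    seq    : ℕ → ℚ
    cauchy : IsCauchy seq

open ℝ public

infix 4 _≃_

record _≃_ (x y : ℝ) : Set where
  constructor mk≃
  field
    close : ∀ ε → 0ℚ ℚ.< ε → Eventually (λ n → ∣ seq x n ℚ.- seq y n ∣ ℚ.< ε)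

open _≃_ public

private

  half-pos : ∀ {ε} → 0ℚ ℚ.< ε → 0ℚ ℚ.< ½ ℚ.* ε
  half-pos {ε} ε>0 =
    subst (ℚ._< ½ ℚ.* ε) (ℚ.*-zeroʳ ½) (ℚ.*-monoʳ-<-pos ½ ε>0)

  half+half : ∀ ε → ½ ℚ.* ε ℚ.+ ½ ℚ.* ε ≡ ε
  half+half ε = trans (sym (ℚ.*-distribʳ-+ ε ½ ½)) (ℚ.*-identityˡ ε)

  add-close : ∀ {ε a b} → ∣ a ∣ ℚ.< ½ ℚ.* ε → ∣ b ∣ ℚ.< ½ ℚ.* ε → ∣ a ℚ.+ b ∣ ℚ.< ε
  add-close {ε} {a} {b} p q = subst (∣ a ℚ.+ b ∣ ℚ.<_) (half+half ε)
    (ℚ.≤-<-trans (ℚ.∣p+q∣≤∣p∣+∣q∣ a b) (ℚ.+-mono-< p q))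

  -‿flip : ∀ a b → b ℚ.- a ≡ ℚ.- (a ℚ.- b)
  -‿flip = solve 2 (λ a b → b :- a := :- (a :- b)) refl
    where open +-*-Solver

  ∣-∣-swap : ∀ a b → ∣ b ℚ.- a ∣ ≡ ∣ a ℚ.- b ∣
  ∣-∣-swap a b = trans (cong ∣_∣ (-‿flip a b)) (ℚ.∣-p∣≡∣p∣ (a ℚ.- b))

  ∣p-p∣<ε : ∀ {p q ε} → p ≡ q → 0ℚ ℚ.< ε → ∣ p ℚ.- q ∣ ℚ.< ε
  ∣p-p∣<ε {p} {ε = ε} refl ε>0 = subst (λ z → ∣ z ∣ ℚ.< ε) (sym (ℚ.+-inverseʳ p)) ε>0

  +-difference : ∀ a b c d → (a ℚ.+ b) ℚ.- (c ℚ.+ d) ≡ (a ℚ.- c) ℚ.+ (b ℚ.- d)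
  +-difference = solve 4 (λ a b c d → (a :+ b) :- (c :+ d) := (a :- c) :+ (b :- d)) refl
    where open +-*-Solver

  *-difference : ∀ a b c d →
    a ℚ.* b ℚ.- c ℚ.* d ≡ a ℚ.* (b ℚ.- d) ℚ.+ (a ℚ.- c) ℚ.* d
  *-difference = solve 4 (λ a b c d → a :* b :- c :* d := a :* (b :- d) :+ (a :- c) :* d) refl
    where open +-*-Solver

  neg-difference : ∀ a b → (ℚ.- a) ℚ.- (ℚ.- b) ≡ ℚ.- (a ℚ.- b)
  neg-difference = solve 2 (λ a b → (:- a) :- (:- b) := :- (a :- b)) refl
    where open +-*-Solver

  telescope : ∀ a b c → a ℚ.- c ≡ (a ℚ.- b) ℚ.+ (b ℚ.- c)
  telescope = solve 3 (λ a b c → a :- c := (a :- b) :+ (b :- c)) refl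
    where open +-*-Solver

  restore : ∀ a b → a ≡ (a ℚ.- b) ℚ.+ b
  restore = solve 2 (λ a b → a := (a :- b) :+ b) refl
    where open +-*-Solver

  +-close : ∀ {ε} a b c d → ∣ a ℚ.- c ∣ ℚ.< ½ ℚ.* ε → ∣ b ℚ.- d ∣ ℚ.< ½ ℚ.* ε →
            ∣ (a ℚ.+ b) ℚ.- (c ℚ.+ d) ∣ ℚ.< ε
  +-close {ε} a b c d p q =
    subst (λ z → ∣ z ∣ ℚ.< ε) (sym (+-difference a b c d)) (add-close {a = a ℚ.- c} p q)

  *-close : ∀ {A B δ} a b c d → .{{_ : Positive A}} → .{{_ : Positive B}} →
            ∣ a ∣ ℚ.≤ A → ∣ d ∣ ℚ.≤ B → ∣ a ℚ.- c ∣ ℚ.< δ → ∣ b ℚ.- d ∣ ℚ.< δ →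
            ∣ a ℚ.* b ℚ.- c ℚ.* d ∣ ℚ.< (A ℚ.+ B) ℚ.* δ
  *-close {A} {B} {δ} a b c d a≤A d≤B ac bd = begin-strict
    ∣ a ℚ.* b ℚ.- c ℚ.* d ∣
      ≡⟨ cong ∣_∣ (*-difference a b c d) ⟩
    ∣ a ℚ.* (b ℚ.- d) ℚ.+ (a ℚ.- c) ℚ.* d ∣
      ≤⟨ ℚ.∣p+q∣≤∣p∣+∣q∣ (a ℚ.* (b ℚ.- d)) ((a ℚ.- c) ℚ.* d) ⟩
    ∣ a ℚ.* (b ℚ.- d) ∣ ℚ.+ ∣ (a ℚ.- c) ℚ.* d ∣
      ≡⟨ cong₂ ℚ._+_ (ℚ.∣p*q∣≡∣p∣*∣q∣ a (b ℚ.- d)) (ℚ.∣p*q∣≡∣p∣*∣q∣ (a ℚ.- c) d) ⟩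
    ∣ a ∣ ℚ.* ∣ b ℚ.- d ∣ ℚ.+ ∣ a ℚ.- c ∣ ℚ.* ∣ d ∣
      ≤⟨ ℚ.+-mono-≤
           (ℚ.*-monoʳ-≤-nonNeg ∣ b ℚ.- d ∣ {{ℚ.nonNegative (ℚ.0≤∣p∣ (b ℚ.- d))}} a≤A)
           (ℚ.*-monoˡ-≤-nonNeg ∣ a ℚ.- c ∣ {{ℚ.nonNegative (ℚ.0≤∣p∣ (a ℚ.- c))}} d≤B) ⟩
    A ℚ.* ∣ b ℚ.- d ∣ ℚ.+ ∣ a ℚ.- c ∣ ℚ.* B
      <⟨ ℚ.+-mono-< (ℚ.*-monoʳ-<-pos A bd) (ℚ.*-monoˡ-<-pos B ac) ⟩
    A ℚ.* δ ℚ.+ δ ℚ.* B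
      ≡⟨ cong (A ℚ.* δ ℚ.+_) (ℚ.*-comm δ B) ⟩
    A ℚ.* δ ℚ.+ B ℚ.* δ
      ≡⟨ sym (ℚ.*-distribʳ-+ δ A B) ⟩
    (A ℚ.+ B) ℚ.* δ ∎
    where open ℚ.≤-Reasoning

  eventually-bounded : ∀ x → Σ[ B ∈ ℚ ] Positive B × Eventually (λ n → ∣ seq x n ∣ ℚ.≤ B)
  eventually-bounded x with cauchy x 1ℚ (ℚ.positive⁻¹ 1ℚ)
  ... | N , c = 1ℚ ℚ.+ ∣ seq x N ∣ , ℚ.positive B>0 , N , λ n N≤n → begin
      ∣ seq x n ∣
        ≡⟨ cong ∣_∣ (restore (seq x n) (seq x N)) ⟩
      ∣ (seq x n ℚ.- seq x N) ℚ.+ seq x N ∣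
        ≤⟨ ℚ.∣p+q∣≤∣p∣+∣q∣ (seq x n ℚ.- seq x N) (seq x N) ⟩
      ∣ seq x n ℚ.- seq x N ∣ ℚ.+ ∣ seq x N ∣
        ≤⟨ ℚ.+-monoˡ-≤ ∣ seq x N ∣ (ℚ.<⇒≤ (c n N N≤n ℕ.≤-refl)) ⟩
      1ℚ ℚ.+ ∣ seq x N ∣ ∎
    where
    open ℚ.≤-Reasoning
    B>0 : 0ℚ ℚ.< 1ℚ ℚ.+ ∣ seq x N ∣
    B>0 = ℚ.+-mono-<-≤ (ℚ.positive⁻¹ 1ℚ) (ℚ.0≤∣p∣ (seq x N))

  scale : ∀ C → .{{_ : Positive C}} → ∀ ε → 0ℚ ℚ.< ε → Σ[ δ ∈ ℚ ] 0ℚ ℚ.< δ × C ℚ.* δ ≡ ε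
  scale C ε ε>0 = C⁻¹ ℚ.* ε , δ>0 , (begin
      C ℚ.* (C⁻¹ ℚ.* ε)  ≡⟨ sym (ℚ.*-assoc C C⁻¹ ε) ⟩
      (C ℚ.* C⁻¹) ℚ.* ε  ≡⟨ cong (ℚ._* ε) (ℚ.*-inverseʳ C {{C≢0}}) ⟩
      1ℚ ℚ.* ε           ≡⟨ ℚ.*-identityˡ ε ⟩
      ε                  ∎)
    where
    open Relation.Binary.PropositionalEquality.≡-Reasoning
    C≢0 : NonZero C
    C≢0 = ℚ.pos⇒nonZero C
    C⁻¹ : ℚ
    C⁻¹ = (1/ C) {{C≢0}}
    δ>0 : 0ℚ ℚ.< C⁻¹ ℚ.* ε
    δ>0 = subst (ℚ._< C⁻¹ ℚ.* ε) (ℚ.*-zeroʳ C⁻¹) (ℚ.*-monoʳ-<-pos C⁻¹ {{ℚ.1/pos⇒pos C}} ε>0)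

  +-cauchy : ∀ x y → IsCauchy (λ n → seq x n ℚ.+ seq y n)
  +-cauchy x y ε ε>0 with cauchy x (½ ℚ.* ε) (half-pos ε>0) | cauchy y (½ ℚ.* ε) (half-pos ε>0)
  ... | M , p | N , q = M ⊔ N , λ m n m≥ n≥ →
    +-close (seq x m) (seq y m) (seq x n) (seq y n)
      (p m n (ℕ.m⊔n≤o⇒m≤o M N m≥) (ℕ.m⊔n≤o⇒m≤o M N n≥))
      (q m n (ℕ.m⊔n≤o⇒n≤o M N m≥) (ℕ.m⊔n≤o⇒n≤o M N n≥))

  *-cauchy : ∀ x y → IsCauchy (λ n → seq x n ℚ.* seq y n)
  *-cauchy x y ε ε>0 =
    let A , A>0 , K , a = eventually-bounded x
        B , B>0 , L , b = eventually-bounded y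
        δ , δ>0 , eq = scale (A ℚ.+ B) {{ℚ.pos+pos⇒pos A {{A>0}} B {{B>0}}}} ε ε>0
        M , p = cauchy x δ δ>0
        N , q = cauchy y δ δ>0
    in (K ⊔ L) ⊔ (M ⊔ N) , λ m n m≥ n≥ →
      let mKL = ℕ.m⊔n≤o⇒m≤o (K ⊔ L) (M ⊔ N) m≥
          mMN = ℕ.m⊔n≤o⇒n≤o (K ⊔ L) (M ⊔ N) m≥
          nKL = ℕ.m⊔n≤o⇒m≤o (K ⊔ L) (M ⊔ N) n≥
          nMN = ℕ.m⊔n≤o⇒n≤o (K ⊔ L) (M ⊔ N) n≥
      in subst (∣ seq x m ℚ.* seq y m ℚ.- seq x n ℚ.* seq y n ∣ ℚ.<_) eq
           (*-close (seq x m) (seq y m) (seq x n) (seq y n) {{A>0}} {{B>0}}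
             (a m (ℕ.m⊔n≤o⇒m≤o K L mKL)) (b n (ℕ.m⊔n≤o⇒n≤o K L nKL))
             (p m n (ℕ.m⊔n≤o⇒m≤o M N mMN) (ℕ.m⊔n≤o⇒m≤o M N nMN))
             (q m n (ℕ.m⊔n≤o⇒n≤o M N mMN) (ℕ.m⊔n≤o⇒n≤o M N nMN)))

  neg-close : ∀ {ε} a b → ∣ a ℚ.- b ∣ ℚ.< ε → ∣ (ℚ.- a) ℚ.- (ℚ.- b) ∣ ℚ.< ε
  neg-close {ε} a b = subst (ℚ._< ε)
    (sym (trans (cong ∣_∣ (neg-difference a b)) (ℚ.∣-p∣≡∣p∣ (a ℚ.- b))))

  neg-cauchy : ∀ x → IsCauchy (λ n → ℚ.- seq x n)
  neg-cauchy x ε ε>0 with cauchy x ε ε>0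
  ... | N , p = N , λ m n m≥ n≥ → neg-close (seq x m) (seq x n) (p m n m≥ n≥)

fromℚ : ℚ → ℝ
fromℚ q = mkℝ (λ _ → q) (λ ε ε>0 → 0 , λ _ _ _ _ → ∣p-p∣<ε {q} refl ε>0)

0ℝ 1ℝ : ℝ
0ℝ = fromℚ 0ℚ
1ℝ = fromℚ 1ℚ

infixl 6 _+ℝ_
infixl 7 _*ℝ_
infix  8 -ℝ_

_+ℝ_ _*ℝ_ : ℝ → ℝ → ℝ
x +ℝ y = mkℝ (λ n → seq x n ℚ.+ seq y n) (+-cauchy x y)
x *ℝ y = mkℝ (λ n → seq x n ℚ.* seq y n) (*-cauchy x y)

-ℝ_ : ℝ → ℝ
-ℝ x = mkℝ (λ n → ℚ.- seq x n) (neg-cauchy x)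

pointwise : ∀ {x y} → (∀ n → seq x n ≡ seq y n) → x ≃ y
pointwise eq = mk≃ λ ε ε>0 → 0 , λ n _ → ∣p-p∣<ε (eq n) ε>0

≃-refl : ∀ {x} → x ≃ x
≃-refl = pointwise λ _ → refl

≃-sym : ∀ {x y} → x ≃ y → y ≃ x
≃-sym {x} {y} x≃y = mk≃ λ ε ε>0 → let N , p = close x≃y ε ε>0 in
  N , λ n n≥ → subst (ℚ._< ε) (∣-∣-swap (seq y n) (seq x n)) (p n n≥)

≃-trans : ∀ {x y z} → x ≃ y → y ≃ z → x ≃ z
≃-trans {x} {y} {z} x≃y y≃z = mk≃ λ ε ε>0 →
  let M , p = close x≃y (½ ℚ.* ε) (half-pos ε>0)
      N , q = close y≃z (½ ℚ.* ε) (half-pos ε>0)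
  in M ⊔ N , λ n n≥ →
       subst (λ w → ∣ w ∣ ℚ.< ε) (sym (telescope (seq x n) (seq y n) (seq z n)))
         (add-close {a = seq x n ℚ.- seq y n}
           (p n (ℕ.m⊔n≤o⇒m≤o M N n≥)) (q n (ℕ.m⊔n≤o⇒n≤o M N n≥)))

+ℝ-cong : ∀ {x y u v} → x ≃ y → u ≃ v → x +ℝ u ≃ y +ℝ v
+ℝ-cong {x} {y} {u} {v} x≃y u≃v = mk≃ λ ε ε>0 →
  let M , p = close x≃y (½ ℚ.* ε) (half-pos ε>0)
      N , q = close u≃v (½ ℚ.* ε) (half-pos ε>0)
  in M ⊔ N , λ n n≥ → +-close (seq x n) (seq u n) (seq y n) (seq v n)
       (p n (ℕ.m⊔n≤o⇒m≤o M N n≥)) (q n (ℕ.m⊔n≤o⇒n≤o M N n≥))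

*ℝ-cong : ∀ {x y u v} → x ≃ y → u ≃ v → x *ℝ u ≃ y *ℝ v
*ℝ-cong {x} {y} {u} {v} x≃y u≃v = mk≃ λ ε ε>0 →
  let A , A>0 , K , a = eventually-bounded x
      B , B>0 , L , b = eventually-bounded v
      δ , δ>0 , eq = scale (A ℚ.+ B) {{ℚ.pos+pos⇒pos A {{A>0}} B {{B>0}}}} ε ε>0
      M , p = close x≃y δ δ>0
      N , q = close u≃v δ δ>0
  in (K ⊔ L) ⊔ (M ⊔ N) , λ n n≥ →
    let nKL = ℕ.m⊔n≤o⇒m≤o (K ⊔ L) (M ⊔ N) n≥
        nMN = ℕ.m⊔n≤o⇒n≤o (K ⊔ L) (M ⊔ N) n≥
    in subst (∣ seq x n ℚ.* seq u n ℚ.- seq y n ℚ.* seq v n ∣ ℚ.<_) eq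
         (*-close (seq x n) (seq u n) (seq y n) (seq v n) {{A>0}} {{B>0}}
           (a n (ℕ.m⊔n≤o⇒m≤o K L nKL)) (b n (ℕ.m⊔n≤o⇒n≤o K L nKL))
           (p n (ℕ.m⊔n≤o⇒m≤o M N nMN)) (q n (ℕ.m⊔n≤o⇒n≤o M N nMN)))

-ℝ-cong : ∀ {x y} → x ≃ y → -ℝ x ≃ -ℝ y
-ℝ-cong {x} {y} x≃y = mk≃ λ ε ε>0 → let N , p = close x≃y ε ε>0 in
  N , λ n n≥ → neg-close (seq x n) (seq y n) (p n n≥)

ℝ-commutativeRing : CommutativeRing 0ℓ 0ℓ
ℝ-commutativeRing = record
  { Carrier = ℝ
  ; _≈_ = _≃_
  ; _+_ = _+ℝ_
  ; _*_ = _*ℝ_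
  ; -_ = -ℝ_
  ; 0# = 0ℝ
  ; 1# = 1ℝ
  ; isCommutativeRing = record
    { isRing = record
      { +-isAbelianGroup = record
        { isGroup = record
          { isMonoid = record
            { isSemigroup = record
              { isMagma = record
                { isEquivalence = record { refl = ≃-refl ; sym = ≃-sym ; trans = ≃-trans }
                ; ∙-cong = +ℝ-cong
                }
              ; assoc = λ x y z → pointwise λ n → ℚ.+-assoc (seq x n) (seq y n) (seq z n)
              }
            ; identity = (λ x → pointwise λ n → ℚ.+-identityˡ (seq x n))
                       , (λ x → pointwise λ n → ℚ.+-identityʳ (seq x n))
            }
          ; inverse = (λ x → pointwise λ n → ℚ.+-inverseˡ (seq x n))
                    , (λ x → pointwise λ n → ℚ.+-inverseʳ (seq x n))
          ; ⁻¹-cong = -ℝ-cong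
          }
        ; comm = λ x y → pointwise λ n → ℚ.+-comm (seq x n) (seq y n)
        }
      ; *-cong = *ℝ-cong
      ; *-assoc = λ x y z → pointwise λ n → ℚ.*-assoc (seq x n) (seq y n) (seq z n)
      ; *-identity = (λ x → pointwise λ n → ℚ.*-identityˡ (seq x n))
                   , (λ x → pointwise λ n → ℚ.*-identityʳ (seq x n))
      ; distrib = (λ x y z → pointwise λ n → ℚ.*-distribˡ-+ (seq x n) (seq y n) (seq z n))
                , (λ x y z → pointwise λ n → ℚ.*-distribʳ-+ (seq x n) (seq y n) (seq z n))
      }
    ; *-comm = λ x y → pointwise λ n → ℚ.*-comm (seq x n) (seq y n)
    }
  }

module Polynomials {c ℓ} (R : CommutativeRing c ℓ) where

  open CommutativeRing R using (_≈_; _+_; _*_; -_; 0#; 1#) renaming (Carrier to A)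

  -- Coefficients are listed from degree 0 upwards; trailing zeros are
  -- allowed, and _≈ₚ_ disregards them.
  Poly : Set c
  Poly = List A

  coeff : Poly → ℕ → A
  coeff []      _       = 0#
  coeff (a ∷ p) zero    = a
  coeff (a ∷ p) (suc n) = coeff p n

  infix 4 _≈ₚ_
  _≈ₚ_ : Poly → Poly → Set ℓ
  p ≈ₚ q = ∀ n → coeff p n ≈ coeff q n

  infixl 6 _+ₚ_
  _+ₚ_ : Poly → Poly → Poly
  []      +ₚ q       = q
  (a ∷ p) +ₚ []      = a ∷ p
  (a ∷ p) +ₚ (b ∷ q) = (a + b) ∷ (p +ₚ q)

  infixl 7 _*ₚ_
  _*ₚ_ : Poly → Poly → Poly
  []      *ₚ q = []
  (a ∷ p) *ₚ q = map (a *_) q +ₚ (0# ∷ (p *ₚ q))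

  0ₚ 1ₚ X : Poly
  0ₚ = []
  1ₚ = 1# ∷ []
  X  = 0# ∷ 1# ∷ []

  X-_ : A → Poly
  X- r = (- r) ∷ 1# ∷ []

  rawSemiring : RawSemiring c ℓ
  rawSemiring = record
    { Carrier = Poly ; _≈_ = _≈ₚ_ ; _+_ = _+ₚ_ ; _*_ = _*ₚ_ ; 0# = 0ₚ ; 1# = 1ₚ }

  open RawSemiringDefs rawSemiring public
    using (_^_; _∣_; _∤_)
    renaming (_×_ to _·_)

  eval : Poly → A → A
  eval p x = foldr (λ a v → a + x * v) 0# p

  IsRoot : Poly → A → Set ℓ
  IsRoot p x = eval p x ≈ 0#

  HasMultiplicity : Poly → A → ℕ → Set (c ⊔ˡ ℓ)
  HasMultiplicity p r k = ((X- r) ^ k ∣ p) × ((X- r) ^ suc k ∤ p)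

  ExactlyOneRootCountedWithMultiplicity : Poly → Set (c ⊔ˡ ℓ)
  ExactlyOneRootCountedWithMultiplicity p =
    Σ[ r ∈ A ] IsRoot p r × (∀ x → IsRoot p x → x ≈ r) × HasMultiplicity p r 1

open Polynomials ℝ-commutativeRing public

-- i · q is the i-fold sum q + ⋯ + q, so (suc m · X) ^ suc m is the
-- summand (iX)^i at i = m + 1.
p : ℕ → Poly
p zero    = 1ₚ
p (suc m) = p m +ₚ (suc m · X) ^ suc m

{-# OPTIONS --safe #-}
module Submission where

-- For x ≤ 0 the sum ∑ cᵢ xⁱ alternates.  If (cᵢ) is positive and log-convex,
-- the absolute values of its terms first decrease and then increase, so a sum
-- with an odd number of terms is nonnegative: pair the terms up on both sides of
-- the turning point.  The coefficients iⁱ of p_m stay log-convex when c₀ = 1 is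
-- lowered to 7/8, and so do the coefficients (j+1)^(j+2) of p_m′.  Hence p_m ≥ 1/8
-- on ℚ for even m, and p_m′ ≥ 1/8 on ℚ for odd m.  In the odd case p_m increases
-- with slope at least 1/8, so it has a sign change on [-8, 0], where bisection
-- finds a root; the slope bound makes this root unique and simple.

open import Algebra.Bundles using (CommutativeRing)
open import Algebra.Definitions.RawMagma using (_,_)
import Algebra.Properties.Ring as RingProperties
import Algebra.Properties.Semiring.Mult as SemiringMult
import Algebra.Solver.Ring.NaturalCoefficients.Default as SemiringSolver
open import Data.List.Base using (List; []; _∷_; map; applyUpTo)
open import Data.Nat.Base as ℕ using (ℕ; zero; suc)
open import Data.Product.Base using (∃-syntax; _×_; _,_; proj₁; proj₂)
open import Function.Base using (_∘_)
open import Relation.Binary.PropositionalEquality as ≡ using (_≡_; module ≡-Reasoning)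
import Relation.Binary.Reasoning.Setoid as SetoidReasoning

open import Defs using (module Polynomials)

-- Polynomials over a commutative ring: coefficients, evaluation and derivative.

module PolynomialProperties {a ℓ} (R : CommutativeRing a ℓ) where

  open CommutativeRing R renaming (Carrier to A)
  open Polynomials R
  open RingProperties ring using (-‿distribˡ-*)
  open SemiringSolver commutativeSemiring using (solve; _:=_; _:+_; _:*_; con)
  open SemiringMult semiring using (×1-homo-*) renaming (_×_ to _×ᴿ_)
  open SetoidReasoning setoid

  infix 9 _·1
  _·1 : ℕ → A
  n ·1 = n ×ᴿ 1#

  coeff-+ₚ : ∀ f g n → coeff (f +ₚ g) n ≈ coeff f n + coeff g n
  coeff-+ₚ []      g       n       = sym (+-identityˡ _)
  coeff-+ₚ (a ∷ f) []      n       = sym (+-identityʳ _)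
  coeff-+ₚ (a ∷ f) (b ∷ g) zero    = refl
  coeff-+ₚ (a ∷ f) (b ∷ g) (suc n) = coeff-+ₚ f g n

  coeff-map : ∀ a f n → coeff (map (a *_) f) n ≈ a * coeff f n
  coeff-map a []      n       = sym (zeroʳ a)
  coeff-map a (b ∷ f) zero    = refl
  coeff-map a (b ∷ f) (suc n) = coeff-map a f n

  coeff-0∷[] : ∀ n → coeff (0# ∷ []) n ≈ 0#
  coeff-0∷[] zero    = refl
  coeff-0∷[] (suc n) = refl

  -- Since `_≈ₚ_` disregards trailing zeros, equal polynomials can be lists of different lengths;
  -- this handles the surplus in `eval-cong`.
  eval-≈0 : ∀ f x → f ≈ₚ 0ₚ → eval f x ≈ 0#
  eval-≈0 []      x f≈0 = refl
  eval-≈0 (a ∷ f) x f≈0 = begin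
    a + x * eval f x  ≈⟨ +-cong (f≈0 0) (*-congˡ (eval-≈0 f x (f≈0 ∘ suc))) ⟩
    0# + x * 0#       ≈⟨ +-identityˡ _ ⟩
    x * 0#            ≈⟨ zeroʳ x ⟩
    0#                ∎

  eval-cong : ∀ f g x → f ≈ₚ g → eval f x ≈ eval g x
  eval-cong []      g       x f≈g = sym (eval-≈0 g x (sym ∘ f≈g))
  eval-cong (a ∷ f) []      x f≈g = eval-≈0 (a ∷ f) x f≈g
  eval-cong (a ∷ f) (b ∷ g) x f≈g = +-cong (f≈g 0) (*-congˡ (eval-cong f g x (f≈g ∘ suc)))

  eval-congʳ : ∀ f {x y} → x ≈ y → eval f x ≈ eval f y
  eval-congʳ []      x≈y = refl
  eval-congʳ (a ∷ f) x≈y = +-congˡ (*-cong x≈y (eval-congʳ f x≈y))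

  -- The value of the derivative, by Horner's scheme.
  eval′ : Poly → A → A
  eval′ []      x = 0#
  eval′ (a ∷ f) x = eval f x + x * eval′ f x

  eval′-≈0 : ∀ f x → f ≈ₚ 0ₚ → eval′ f x ≈ 0#
  eval′-≈0 []      x f≈0 = refl
  eval′-≈0 (a ∷ f) x f≈0 = begin
    eval f x + x * eval′ f x
      ≈⟨ +-cong (eval-≈0 f x (f≈0 ∘ suc)) (*-congˡ (eval′-≈0 f x (f≈0 ∘ suc))) ⟩
    0# + x * 0#  ≈⟨ +-identityˡ _ ⟩
    x * 0#       ≈⟨ zeroʳ x ⟩
    0#           ∎

  eval′-cong : ∀ f g x → f ≈ₚ g → eval′ f x ≈ eval′ g x
  eval′-cong []      g       x f≈g = sym (eval′-≈0 g x (sym ∘ f≈g))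
  eval′-cong (a ∷ f) []      x f≈g = eval′-≈0 (a ∷ f) x f≈g
  eval′-cong (a ∷ f) (b ∷ g) x f≈g =
    +-cong (eval-cong f g x (f≈g ∘ suc)) (*-congˡ (eval′-cong f g x (f≈g ∘ suc)))

  eval-+ₚ : ∀ f g x → eval (f +ₚ g) x ≈ eval f x + eval g x
  eval-+ₚ []      g       x = sym (+-identityˡ _)
  eval-+ₚ (a ∷ f) []      x = sym (+-identityʳ _)
  eval-+ₚ (a ∷ f) (b ∷ g) x = begin
    (a + b) + x * eval (f +ₚ g) x         ≈⟨ +-congˡ (*-congˡ (eval-+ₚ f g x)) ⟩
    (a + b) + x * (eval f x + eval g x)
      ≈⟨ solve 5 (λ a b x u v → (a :+ b) :+ x :* (u :+ v) := (a :+ x :* u) :+ (b :+ x :* v))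
           refl a b x (eval f x) (eval g x) ⟩
    (a + x * eval f x) + (b + x * eval g x) ∎

  eval′-+ₚ : ∀ f g x → eval′ (f +ₚ g) x ≈ eval′ f x + eval′ g x
  eval′-+ₚ []      g       x = sym (+-identityˡ _)
  eval′-+ₚ (a ∷ f) []      x = sym (+-identityʳ _)
  eval′-+ₚ (a ∷ f) (b ∷ g) x = begin
    eval (f +ₚ g) x + x * eval′ (f +ₚ g) x
      ≈⟨ +-cong (eval-+ₚ f g x) (*-congˡ (eval′-+ₚ f g x)) ⟩
    (eval f x + eval g x) + x * (eval′ f x + eval′ g x)
      ≈⟨ solve 5 (λ a b x u v → (a :+ b) :+ x :* (u :+ v) := (a :+ x :* u) :+ (b :+ x :* v))
           refl (eval f x) (eval g x) x (eval′ f x) (eval′ g x) ⟩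
    (eval f x + x * eval′ f x) + (eval g x + x * eval′ g x) ∎

  eval-map : ∀ a f x → eval (map (a *_) f) x ≈ a * eval f x
  eval-map a []      x = sym (zeroʳ a)
  eval-map a (b ∷ f) x = begin
    a * b + x * eval (map (a *_) f) x  ≈⟨ +-congˡ (*-congˡ (eval-map a f x)) ⟩
    a * b + x * (a * eval f x)
      ≈⟨ solve 4 (λ a b x u → a :* b :+ x :* (a :* u) := a :* (b :+ x :* u))
           refl a b x (eval f x) ⟩
    a * (b + x * eval f x)             ∎

  eval′-map : ∀ a f x → eval′ (map (a *_) f) x ≈ a * eval′ f x
  eval′-map a []      x = sym (zeroʳ a)
  eval′-map a (b ∷ f) x = begin
    eval (map (a *_) f) x + x * eval′ (map (a *_) f) x
      ≈⟨ +-cong (eval-map a f x) (*-congˡ (eval′-map a f x)) ⟩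
    a * eval f x + x * (a * eval′ f x)
      ≈⟨ solve 4 (λ a b x u → a :* b :+ x :* (a :* u) := a :* (b :+ x :* u))
           refl a (eval f x) x (eval′ f x) ⟩
    a * (eval f x + x * eval′ f x)     ∎

  eval-*ₚ : ∀ f g x → eval (f *ₚ g) x ≈ eval f x * eval g x
  eval-*ₚ []      g x = sym (zeroˡ _)
  eval-*ₚ (a ∷ f) g x = begin
    eval (map (a *_) g +ₚ (0# ∷ (f *ₚ g))) x
      ≈⟨ eval-+ₚ (map (a *_) g) _ x ⟩
    eval (map (a *_) g) x + (0# + x * eval (f *ₚ g) x)
      ≈⟨ +-cong (eval-map a g x) (trans (+-identityˡ _) (*-congˡ (eval-*ₚ f g x))) ⟩
    a * eval g x + x * (eval f x * eval g x)
      ≈⟨ solve 4 (λ a g x f → a :* g :+ x :* (f :* g) := (a :+ x :* f) :* g)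
           refl a (eval g x) x (eval f x) ⟩
    (a + x * eval f x) * eval g x ∎

  eval′-*ₚ : ∀ f g x → eval′ (f *ₚ g) x ≈ eval′ f x * eval g x + eval f x * eval′ g x
  eval′-*ₚ []      g x = sym (trans (+-cong (zeroˡ _) (zeroˡ _)) (+-identityˡ _))
  eval′-*ₚ (a ∷ f) g x = begin
    eval′ (map (a *_) g +ₚ (0# ∷ (f *ₚ g))) x
      ≈⟨ eval′-+ₚ (map (a *_) g) _ x ⟩
    eval′ (map (a *_) g) x + (eval (f *ₚ g) x + x * eval′ (f *ₚ g) x)
      ≈⟨ +-cong (eval′-map a g x) (+-cong (eval-*ₚ f g x) (*-congˡ (eval′-*ₚ f g x))) ⟩
    a * eval′ g x + (eval f x * eval g x + x * (eval′ f x * eval g x + eval f x * eval′ g x))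
      ≈⟨ solve 6 (λ a g g′ x f f′ → a :* g′ :+ (f :* g :+ x :* (f′ :* g :+ f :* g′))
                      := (f :+ x :* f′) :* g :+ (a :+ x :* f) :* g′)
           refl a (eval g x) (eval′ g x) x (eval f x) (eval′ f x) ⟩
    (eval f x + x * eval′ f x) * eval g x + (a + x * eval f x) * eval′ g x ∎

  -- Linear factors: double roots and the factor theorem.

  eval-X- : ∀ r → eval (X- r) r ≈ 0#
  eval-X- r = begin
    - r + r * (1# + r * 0#)
      ≈⟨ +-congˡ (trans (*-congˡ (trans (+-congˡ (zeroʳ r)) (+-identityʳ 1#))) (*-identityʳ r)) ⟩
    - r + r  ≈⟨ -‿inverseˡ r ⟩
    0#       ∎

  -- By the product rule, every term of the derivative of g (X - r)² keeps a factor X - r.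
  double-root : ∀ f r → (X- r) ^ 2 ∣ f → eval′ f r ≈ 0#
  double-root f r (g , g*L²≈f) = begin
    eval′ f r
      ≈⟨ eval′-cong (g *ₚ (L *ₚ M)) f r g*L²≈f ⟨
    eval′ (g *ₚ (L *ₚ M)) r
      ≈⟨ eval′-*ₚ g (L *ₚ M) r ⟩
    eval′ g r * eval (L *ₚ M) r + eval g r * eval′ (L *ₚ M) r
      ≈⟨ +-cong (*-congˡ (eval-*ₚ L M r)) (*-congˡ (eval′-*ₚ L M r)) ⟩
    eval′ g r * (eval L r * eval M r) + eval g r * (eval′ L r * eval M r + eval L r * eval′ M r)
      ≈⟨ +-cong (*-congˡ (*-cong L≈0 M≈0))
                (*-congˡ (+-cong (*-congˡ M≈0) (*-congʳ L≈0))) ⟩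
    eval′ g r * (0# * 0#) + eval g r * (eval′ L r * 0# + 0# * eval′ M r)
      ≈⟨ solve 4 (λ g g′ l m → g′ :* (con 0 :* con 0) :+ g :* (l :* con 0 :+ con 0 :* m) := con 0)
           refl (eval g r) (eval′ g r) (eval′ L r) (eval′ M r) ⟩
    0# ∎
    where
    L M : Poly
    L = X- r
    -- The unfolding of `L ^ 1`, so that `L *ₚ M` is `L ^ 2` by definition.
    M = L *ₚ 1ₚ
    L≈0 : eval L r ≈ 0#
    L≈0 = eval-X- r
    M≈0 : eval M r ≈ 0#
    M≈0 = trans (eval-*ₚ L 1ₚ r) (trans (*-congʳ L≈0) (zeroˡ _))

  -- Synthetic division by X - r.
  quotient : Poly → A → Poly
  quotient []      r = []
  quotient (a ∷ f) r = eval f r ∷ quotient f r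

  module _ (r : A) where

    private
      L : Poly
      L = (X- r) ^ 1

    -- `(X- r) ^ 1` unfolds to a product with `1ₚ`, so its coefficients are `- r * 1# + 0#` and
    -- `1# * 1# + 0#` and still have to be simplified.
    coeff-*L-zero : ∀ a g → coeff ((a ∷ g) *ₚ L) 0 ≈ - (r * a)
    coeff-*L-zero a g = begin
      a * (- r * 1# + 0#) + 0#  ≈⟨ solve 2 (λ a s → a :* (s :* con 1 :+ con 0) :+ con 0 := s :* a) refl a (- r) ⟩
      - r * a                   ≈⟨ -‿distribˡ-* r a ⟨
      - (r * a)                 ∎

    coeff-*L-one : ∀ a g → coeff ((a ∷ g) *ₚ L) 1 ≈ a + coeff (g *ₚ L) 0
    coeff-*L-one a g = begin
      coeff ((a * (1# * 1# + 0#) ∷ []) +ₚ (g *ₚ L)) 0  ≈⟨ coeff-+ₚ (_ ∷ []) (g *ₚ L) 0 ⟩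
      a * (1# * 1# + 0#) + coeff (g *ₚ L) 0
        ≈⟨ solve 2 (λ a s → a :* (con 1 :* con 1 :+ con 0) :+ s := a :+ s) refl a _ ⟩
      a + coeff (g *ₚ L) 0 ∎

    coeff-*L-suc : ∀ a g n → coeff ((a ∷ g) *ₚ L) (suc (suc n)) ≈ coeff (g *ₚ L) (suc n)
    coeff-*L-suc a g n = trans (coeff-+ₚ (_ ∷ []) (g *ₚ L) (suc n)) (+-identityˡ _)

    -- The division reads f = quotient · (X - r) + f(r). Only the constant coefficient sees the
    -- remainder, hence the separate statement for positive degrees; at a root the remainder
    -- vanishes.
    coeff-quotient-zero : ∀ f → coeff (quotient f r *ₚ L) 0 + eval f r ≈ coeff f 0
    coeff-quotient-zero []      = +-identityˡ _
    coeff-quotient-zero (a ∷ f) = begin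
      coeff ((eval f r ∷ quotient f r) *ₚ L) 0 + (a + r * eval f r)
        ≈⟨ +-cong (coeff-*L-zero (eval f r) (quotient f r)) (+-comm _ _) ⟩
      - (r * eval f r) + (r * eval f r + a)  ≈⟨ +-assoc _ _ _ ⟨
      (- (r * eval f r) + r * eval f r) + a  ≈⟨ +-congʳ (-‿inverseˡ _) ⟩
      0# + a                                 ≈⟨ +-identityˡ a ⟩
      a                                      ∎

    coeff-quotient-suc : ∀ f n → coeff (quotient f r *ₚ L) (suc n) ≈ coeff f (suc n)
    coeff-quotient-suc []      n       = refl
    coeff-quotient-suc (a ∷ f) zero    = begin
      coeff ((eval f r ∷ quotient f r) *ₚ L) 1     ≈⟨ coeff-*L-one (eval f r) (quotient f r) ⟩
      eval f r + coeff (quotient f r *ₚ L) 0       ≈⟨ +-comm _ _ ⟩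
      coeff (quotient f r *ₚ L) 0 + eval f r       ≈⟨ coeff-quotient-zero f ⟩
      coeff f 0                                    ∎
    coeff-quotient-suc (a ∷ f) (suc n) =
      trans (coeff-*L-suc (eval f r) (quotient f r) n) (coeff-quotient-suc f n)

    factor-theorem : ∀ f → IsRoot f r → (X- r) ^ 1 ∣ f
    factor-theorem f root = quotient f r , λ where
      zero    → trans (sym (+-identityʳ _)) (trans (+-congˡ (sym root)) (coeff-quotient-zero f))
      (suc n) → coeff-quotient-suc f n

  -- The coefficients of p_m.

  coeff-linear-*-zero : ∀ {z} a g → z ≈ 0# → coeff ((z ∷ a ∷ []) *ₚ g) 0 ≈ 0#
  coeff-linear-*-zero {z} a g z≈0 = begin
    coeff (map (z *_) g +ₚ _) 0   ≈⟨ coeff-+ₚ (map (z *_) g) _ 0 ⟩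
    coeff (map (z *_) g) 0 + 0#   ≈⟨ +-identityʳ _ ⟩
    coeff (map (z *_) g) 0        ≈⟨ coeff-map z g 0 ⟩
    z * coeff g 0                 ≈⟨ *-congʳ z≈0 ⟩
    0# * coeff g 0                ≈⟨ zeroˡ _ ⟩
    0#                            ∎

  coeff-linear-*-suc : ∀ {z} a g n → z ≈ 0# →
    coeff ((z ∷ a ∷ []) *ₚ g) (suc n) ≈ a * coeff g n
  coeff-linear-*-suc {z} a g n z≈0 = begin
    coeff (map (z *_) g +ₚ _) (suc n)
      ≈⟨ coeff-+ₚ (map (z *_) g) _ (suc n) ⟩
    coeff (map (z *_) g) (suc n) + coeff (map (a *_) g +ₚ (0# ∷ [])) n
      ≈⟨ +-cong (coeff-map z g (suc n)) (coeff-+ₚ (map (a *_) g) (0# ∷ []) n) ⟩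
    z * coeff g (suc n) + (coeff (map (a *_) g) n + coeff (0# ∷ []) n)
      ≈⟨ +-cong (*-congʳ z≈0) (+-cong (coeff-map a g n) (coeff-0∷[] n)) ⟩
    0# * coeff g (suc n) + (a * coeff g n + 0#)
      ≈⟨ solve 2 (λ u v → con 0 :* u :+ (v :+ con 0) := v) refl (coeff g (suc n)) (a * coeff g n) ⟩
    a * coeff g n ∎

  monomial : ℕ → A → Poly
  monomial zero    a = a ∷ []
  monomial (suc k) a = 0# ∷ monomial k a

  coeff-monomial-* : ∀ k {a b c} j → a * b ≈ c → a * coeff (monomial k b) j ≈ coeff (monomial k c) j
  coeff-monomial-* zero    zero    ab≈c = ab≈c
  coeff-monomial-* zero    (suc j) ab≈c = zeroʳ _
  coeff-monomial-* (suc k) zero    ab≈c = zeroʳ _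
  coeff-monomial-* (suc k) (suc j) ab≈c = coeff-monomial-* k j ab≈c

  -- The n-fold sum computes to a list of two entries, but these are iterated sums that equal 0 and
  -- n + 1 only up to `_≈_`. The count starts at 1 because `0 · X` is the empty list.
  1+n·X-linear : ∀ n → ∃[ z ] ∃[ a ] suc n · X ≡ z ∷ a ∷ [] × z ≈ 0# × a ≈ suc n ·1
  1+n·X-linear zero    = 0# , 1# , ≡.refl , refl , sym (+-identityʳ 1#)
  1+n·X-linear (suc n) =
    let z , a , eq , z≈0 , a≈ = 1+n·X-linear n
    in 0# + z , 1# + a , ≡.cong (X +ₚ_) eq , trans (+-identityˡ z) z≈0 , +-congˡ a≈

  linear-^ : ∀ {z a} n → z ≈ 0# → a ≈ n ·1 →
    ∀ k → (z ∷ a ∷ []) ^ k ≈ₚ monomial k ((n ℕ.^ k) ·1)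
  linear-^ n z≈0 a≈n zero zero    = sym (+-identityʳ 1#)
  linear-^ n z≈0 a≈n zero (suc j) = refl
  linear-^ {z} {a} n z≈0 a≈n (suc k) zero    = coeff-linear-*-zero a ((z ∷ a ∷ []) ^ k) z≈0
  linear-^ {z} {a} n z≈0 a≈n (suc k) (suc j) = begin
    coeff ((z ∷ a ∷ []) ^ suc k) (suc j)            ≈⟨ coeff-linear-*-suc a ((z ∷ a ∷ []) ^ k) j z≈0 ⟩
    a * coeff ((z ∷ a ∷ []) ^ k) j                  ≈⟨ *-cong a≈n (linear-^ n z≈0 a≈n k j) ⟩
    (n ·1) * coeff (monomial k ((n ℕ.^ k) ·1)) j
      ≈⟨ coeff-monomial-* k j (sym (×1-homo-* n (n ℕ.^ k))) ⟩
    coeff (monomial k ((n ℕ.^ suc k) ·1)) j         ∎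

  [1+n·X]^k≈monomial : ∀ n k → (suc n · X) ^ k ≈ₚ monomial k ((suc n ℕ.^ k) ·1)
  [1+n·X]^k≈monomial n k =
    let z , a , eq , z≈0 , a≈ = 1+n·X-linear n
    in ≡.subst (λ f → f ^ k ≈ₚ monomial k ((suc n ℕ.^ k) ·1)) (≡.sym eq) (linear-^ (suc n) z≈0 a≈ k)

  coeff-applyUpTo-suc : ∀ m c j →
    coeff (applyUpTo c (suc m)) j ≈ coeff (applyUpTo c m) j + coeff (monomial m (c m)) j
  coeff-applyUpTo-suc zero    c j       = sym (+-identityˡ _)
  coeff-applyUpTo-suc (suc m) c zero    = sym (+-identityʳ _)
  coeff-applyUpTo-suc (suc m) c (suc j) = coeff-applyUpTo-suc m (c ∘ suc) j

  -- Defs.p with ℝ replaced by R.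
  pᴿ : ℕ → Poly
  pᴿ zero    = 1ₚ
  pᴿ (suc m) = pᴿ m +ₚ (suc m · X) ^ suc m

  -- As `0 ^ 0` is 1 in ℕ, the value at 0 is the constant term of p_m.
  selfPower : ℕ → A
  selfPower i = (i ℕ.^ i) ·1

  pᴿ≈applyUpTo : ∀ m → pᴿ m ≈ₚ applyUpTo selfPower (suc m)
  pᴿ≈applyUpTo zero    zero    = sym (+-identityʳ 1#)
  pᴿ≈applyUpTo zero    (suc j) = refl
  pᴿ≈applyUpTo (suc m) j       = begin
    coeff (pᴿ m +ₚ (suc m · X) ^ suc m) j
      ≈⟨ coeff-+ₚ (pᴿ m) ((suc m · X) ^ suc m) j ⟩
    coeff (pᴿ m) j + coeff ((suc m · X) ^ suc m) j
      ≈⟨ +-cong (pᴿ≈applyUpTo m j) ([1+n·X]^k≈monomial m (suc m) j) ⟩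
    coeff (applyUpTo selfPower (suc m)) j + coeff (monomial (suc m) (selfPower (suc m))) j
      ≈⟨ coeff-applyUpTo-suc (suc m) selfPower j ⟨
    coeff (applyUpTo selfPower (suc (suc m))) j ∎

import Data.Nat.Properties as ℕₚ
import Data.Nat.Solver as ℕ-Solver
open import Relation.Binary.PropositionalEquality using (refl; sym; trans; cong; cong₂; subst)

-- Log-convexity of the two coefficient sequences, in ℕ.

module _ where
  open import Data.Nat.Base using (_+_; _*_; _^_; _≤_)
  open ℕₚ.≤-Reasoning
  open ℕ-Solver.+-*-Solver

  ^-distribʳ-* : ∀ n a b → (a * b) ^ n ≡ a ^ n * b ^ n
  ^-distribʳ-* zero    a b = refl
  ^-distribʳ-* (suc n) a b = trans (cong (a * b *_) (^-distribʳ-* n a b))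
    (solve 4 (λ a b A B → a :* b :* (A :* B) := (a :* A) :* (b :* B)) refl a b (a ^ n) (b ^ n))

  -- Bernoulli's inequality (1 - 1/N)^i ≥ 1 - i/N for N = M + 1, cleared of denominators and of
  -- subtraction.
  bernoulli : ∀ M i → suc M ^ i * suc M ≤ M ^ i * suc M + i * suc M ^ i
  bernoulli M zero    = ℕₚ.≤-reflexive (sym (ℕₚ.+-identityʳ _))
  bernoulli M (suc i) = begin
    (suc M * P) * suc M
      ≡⟨ solve 2 (λ M P → ((con 1 :+ M) :* P) :* (con 1 :+ M)
                    := M :* (P :* (con 1 :+ M)) :+ P :* (con 1 :+ M)) refl M P ⟩
    M * (P * suc M) + P * suc M
      ≤⟨ ℕₚ.+-monoˡ-≤ _ (ℕₚ.*-monoʳ-≤ M (bernoulli M i)) ⟩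
    M * (Q * suc M + i * P) + P * suc M
      ≤⟨ ℕₚ.m≤m+n _ (i * P) ⟩
    M * (Q * suc M + i * P) + P * suc M + i * P
      ≡⟨ solve 4 (λ M P Q i → M :* (Q :* (con 1 :+ M) :+ i :* P) :+ P :* (con 1 :+ M) :+ i :* P
                    := M :* Q :* (con 1 :+ M) :+ (con 1 :+ i) :* ((con 1 :+ M) :* P)) refl M P Q i ⟩
    M * Q * suc M + suc i * (suc M * P) ∎
    where
    P Q : ℕ
    P = suc M ^ i
    Q = M ^ i

  -- With n = j + 2 this is N ^ n * n² ≤ (N - 1) ^ n * (n + 1)² for N = n², where
  -- Bernoulli gives N ^ n * (N - n) ≤ (N - 1) ^ n * N.
  ^-log-convex : ∀ j →
    (2 + j) ^ (3 + j) * (2 + j) ^ (3 + j) ≤ (1 + j) ^ (2 + j) * (3 + j) ^ (4 + j)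
  ^-log-convex j = begin
    (n * n ^ n) * (n * n ^ n)
      ≡⟨ solve 2 (λ n P → (n :* P) :* (n :* P) := (P :* P) :* (n :* n)) refl n (n ^ n) ⟩
    (n ^ n * n ^ n) * (n * n)
      ≡⟨ cong (_* (n * n)) (^-distribʳ-* n n n) ⟨
    (n * n) ^ n * (n * n)
      ≡⟨ cong (λ N → N ^ n * (n * n)) n²≡1+M ⟩
    N ^ n * (n * n)
      ≤⟨ ℕₚ.*-cancelʳ-≤ _ _ N cancelled ⟩
    M ^ n * (k * k)
      ≡⟨ cong (_* (k * k)) (^-distribʳ-* n (1 + j) k) ⟩
    ((1 + j) ^ n * k ^ n) * (k * k)
      ≡⟨ solve 3 (λ A B k → (A :* B) :* (k :* k) := A :* (k :* (k :* B))) refl ((1 + j) ^ n) (k ^ n) k ⟩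
    (1 + j) ^ n * k ^ (2 + n) ∎
    where
    n k M N D : ℕ
    n = 2 + j
    k = 3 + j
    -- `M` is (n - 1)(n + 1) = n² - 1 and `D` is n² - n = N - n, both written without subtraction.
    M = (1 + j) * k
    N = suc M
    D = (1 + j) * n
    n²≡1+M : n * n ≡ N
    n²≡1+M = solve 1 (λ j → (con 2 :+ j) :* (con 2 :+ j) := con 1 :+ (con 1 :+ j) :* (con 3 :+ j)) refl j
    N≡D+n : N ≡ D + n
    N≡D+n = solve 1 (λ j → con 1 :+ (con 1 :+ j) :* (con 3 :+ j)
                         := (con 1 :+ j) :* (con 2 :+ j) :+ (con 2 :+ j)) refl j
    ND≤MN : N ^ n * D ≤ M ^ n * N
    ND≤MN = ℕₚ.+-cancelʳ-≤ (n * N ^ n) _ _ (begin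
      N ^ n * D + n * N ^ n
        ≡⟨ solve 3 (λ P D n → P :* D :+ n :* P := P :* (D :+ n)) refl (N ^ n) D n ⟩
      N ^ n * (D + n)       ≡⟨ cong (N ^ n *_) N≡D+n ⟨
      N ^ n * N             ≤⟨ bernoulli M n ⟩
      M ^ n * N + n * N ^ n ∎)
    n⁴≤Dk² : (n * n) * N ≤ D * (k * k)
    n⁴≤Dk² = begin
      -- The difference n (n - 1) (n + 1)² - n⁴ is n (n² - n - 1), and n² - n - 1 = j² + 3 j + 1.
      (n * n) * N                               ≤⟨ ℕₚ.m≤m+n _ (n * (j * j + 3 * j + 1)) ⟩
      (n * n) * N + n * (j * j + 3 * j + 1)
        ≡⟨ solve 1 (λ j → let n = con 2 :+ j ; k = con 3 :+ j in
             (n :* n) :* (con 1 :+ (con 1 :+ j) :* k) :+ n :* (j :* j :+ con 3 :* j :+ con 1)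
               := ((con 1 :+ j) :* n) :* (k :* k)) refl j ⟩
      D * (k * k) ∎
    cancelled : N ^ n * (n * n) * N ≤ M ^ n * (k * k) * N
    cancelled = begin
      N ^ n * (n * n) * N    ≡⟨ ℕₚ.*-assoc (N ^ n) _ _ ⟩
      N ^ n * ((n * n) * N)  ≤⟨ ℕₚ.*-monoʳ-≤ (N ^ n) n⁴≤Dk² ⟩
      N ^ n * (D * (k * k))  ≡⟨ ℕₚ.*-assoc (N ^ n) _ _ ⟨
      N ^ n * D * (k * k)    ≤⟨ ℕₚ.*-monoˡ-≤ (k * k) ND≤MN ⟩
      M ^ n * N * (k * k)    ≡⟨ solve 3 (λ P N K → P :* N :* K := P :* K :* N) refl (M ^ n) N (k * k) ⟩
      M ^ n * (k * k) * N    ∎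

  -- For i > 0, ^-log-convex divided by (i + 1)² ≥ i (i + 2).
  self-power-log-convex : ∀ i →
    (1 + i) ^ (1 + i) * (1 + i) ^ (1 + i) ≤ i ^ i * (2 + i) ^ (2 + i)
  self-power-log-convex zero    = ℕ.s≤s ℕ.z≤n
  self-power-log-convex (suc j) = ℕₚ.*-cancelˡ-≤ ((1 + j) * k) (begin
    ((1 + j) * k) * (P * P)       ≤⟨ ℕₚ.*-monoˡ-≤ (P * P) (ℕₚ.n≤1+n ((1 + j) * k)) ⟩
    suc ((1 + j) * k) * (P * P)
      ≡⟨ solve 2 (λ j P → (con 1 :+ (con 1 :+ j) :* (con 3 :+ j)) :* (P :* P)
                    := ((con 2 :+ j) :* P) :* ((con 2 :+ j) :* P)) refl j P ⟩
    (n * P) * (n * P)             ≤⟨ ^-log-convex j ⟩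
    (1 + j) ^ n * k ^ (1 + k)
      ≡⟨ solve 4 (λ a b k K → (a :* b) :* (k :* K) := (a :* k) :* (b :* K)) refl
           (1 + j) ((1 + j) ^ (1 + j)) k (k ^ k) ⟩
    ((1 + j) * k) * ((1 + j) ^ (1 + j) * k ^ k) ∎)
    where
    n k P : ℕ
    n = 2 + j
    k = 3 + j
    P = n ^ n

open import Defs
import Data.Integer.Base as ℤ
import Data.Integer.Properties as ℤₚ
open import Data.Nat.Divisibility using (divides) renaming (_∣_ to _∣ℕ_; _∤_ to _∤ℕ_)
open import Data.Rational.Base hiding (_≃_)
open import Data.Rational.Properties hiding (≃-sym)
open import Data.Rational.Solver using (module +-*-Solver)
open import Data.Rational.Unnormalised.Base as ℚᵘ using (mkℚᵘ)
import Data.Rational.Unnormalised.Properties as ℚᵘₚ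
open import Data.Sum.Base using (_⊎_; inj₁; inj₂)
open import Data.Unit.Base using (tt)
open import Relation.Nullary.Decidable.Core using (yes; no)
open import Relation.Nullary.Negation using (¬_; contradiction)

open +-*-Solver using (solve; _:=_; _:+_; _:*_; _:-_; :-_; con)

module ℝ[X] = PolynomialProperties ℝ-commutativeRing
open Polynomials +-*-commutativeRing using () renaming (eval to evalℚ)
open PolynomialProperties +-*-commutativeRing using () renaming (eval′ to eval′ℚ)
open SemiringMult (CommutativeRing.semiring +-*-commutativeRing) using (×1-homo-*; ×-homo-+) renaming (_×_ to _·ℚ_)

-- Order and absolute value on ℚ, and the embedding of ℕ.

0≤+ : ∀ {a b} → 0ℚ ≤ a → 0ℚ ≤ b → 0ℚ ≤ a + b
0≤+ 0≤a 0≤b = +-mono-≤ 0≤a 0≤b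

0≤* : ∀ {a b} → 0ℚ ≤ a → 0ℚ ≤ b → 0ℚ ≤ a * b
0≤* {a} {b} 0≤a 0≤b =
  nonNegative⁻¹ (a * b) {{nonNeg*nonNeg⇒nonNeg a {{nonNegative 0≤a}} b {{nonNegative 0≤b}}}}

0≤² : ∀ a → 0ℚ ≤ a * a
0≤² a with ≤-total 0ℚ a
... | inj₁ 0≤a = 0≤* 0≤a 0≤a
... | inj₂ a≤0 = subst (_≤ a * a) (*-zeroʳ a) (*-monoˡ-≤-nonPos a {{nonPositive a≤0}} a≤0)

p≤q⇒0≤q-p : ∀ {p q} → p ≤ q → 0ℚ ≤ q - p
p≤q⇒0≤q-p {p} {q} p≤q = subst (_≤ q - p) (+-inverseʳ p) (+-monoˡ-≤ (- p) p≤q)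

0≤q-p⇒p≤q : ∀ {p q} → 0ℚ ≤ q - p → p ≤ q
0≤q-p⇒p≤q {p} {q} 0≤d = begin
  p            ≡⟨ +-identityˡ p ⟨
  0ℚ + p       ≤⟨ +-monoˡ-≤ p 0≤d ⟩
  (q - p) + p  ≡⟨ solve 2 (λ p q → (q :- p) :+ p := q) refl p q ⟩
  q            ∎
  where open ≤-Reasoning

p<q⇒0<q-p : ∀ {p q} → p < q → 0ℚ < q - p
p<q⇒0<q-p {p} {q} p<q = subst (_< q - p) (+-inverseʳ p) (+-monoˡ-< (- p) p<q)

p≤∣p∣ : ∀ p → p ≤ ∣ p ∣
p≤∣p∣ p with ≤-total 0ℚ p
... | inj₁ 0≤p = ≤-reflexive (sym (0≤p⇒∣p∣≡p 0≤p))
... | inj₂ p≤0 = ≤-trans p≤0 (0≤∣p∣ p)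

-p≤∣p∣ : ∀ p → - p ≤ ∣ p ∣
-p≤∣p∣ p = subst (- p ≤_) (∣-p∣≡∣p∣ p) (p≤∣p∣ (- p))

∣p∣≤ : ∀ {p b} → p ≤ b → - p ≤ b → ∣ p ∣ ≤ b
∣p∣≤ {p} {b} p≤b -p≤b with ∣p∣≡p∨∣p∣≡-p p
... | inj₁ eq = subst (_≤ b) (sym eq) p≤b
... | inj₂ eq = subst (_≤ b) (sym eq) -p≤b

∣p-q∣≡∣q-p∣ : ∀ p q → ∣ p - q ∣ ≡ ∣ q - p ∣
∣p-q∣≡∣q-p∣ p q = trans (cong ∣_∣ (solve 2 (λ p q → p :- q := :- (q :- p)) refl p q)) (∣-p∣≡∣p∣ (q - p))

-- An n-fold sum, so that the semiring laws of multiples apply to it and `seq-·1` can match it with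
-- `_·1` in ℝ by induction.
ι : ℕ → ℚ
ι n = n ·ℚ 1ℚ

ι-* : ∀ m n → ι (m ℕ.* n) ≡ ι m * ι n
ι-* = ×1-homo-*

0≤ι : ∀ n → 0ℚ ≤ ι n
0≤ι zero    = ≤-refl
0≤ι (suc n) = 0≤+ (nonNegative⁻¹ 1ℚ) (0≤ι n)

0<ι : ∀ n → .{{ℕ.NonZero n}} → 0ℚ < ι n
0<ι (suc n) = +-mono-<-≤ (positive⁻¹ 1ℚ) (0≤ι n)

ι-mono-≤ : ∀ {m n} → m ℕ.≤ n → ι m ≤ ι n
ι-mono-≤ {m} {n} m≤n = begin
  ι m                 ≡⟨ +-identityʳ (ι m) ⟨
  ι m + 0ℚ            ≤⟨ +-monoʳ-≤ (ι m) (0≤ι (n ℕ.∸ m)) ⟩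
  ι m + ι (n ℕ.∸ m)   ≡⟨ ×-homo-+ 1ℚ m (n ℕ.∸ m) ⟨
  ι (m ℕ.+ (n ℕ.∸ m)) ≡⟨ cong ι (ℕₚ.m+[n∸m]≡n m≤n) ⟩
  ι n                 ∎
  where open ≤-Reasoning

toℚᵘ-ι : ∀ n → toℚᵘ (ι n) ℚᵘ.≃ mkℚᵘ (ℤ.+ n) 0
toℚᵘ-ι zero    = ℚᵘ.*≡* refl
toℚᵘ-ι (suc n) = ℚᵘₚ.≃-trans (toℚᵘ-homo-+ 1ℚ (ι n))
  (ℚᵘₚ.≃-trans (ℚᵘₚ.+-congʳ (toℚᵘ 1ℚ) (toℚᵘ-ι n))
    (ℚᵘ.*≡* (cong (λ k → (ℤ.+ 1 ℤ.+ k) ℤ.* ℤ.+ 1) (ℤₚ.*-identityʳ (ℤ.+ n)))))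

-- A nonnegative fraction is at most its numerator, the denominator being at least 1.
p≤ι : ∀ p → ∃[ n ] p ≤ ι n
p≤ι p@(mkℚ (ℤ.-[1+ _ ]) _ _)  = 0 , <⇒≤ (negative⁻¹ p)
p≤ι (mkℚ (ℤ.+ n) d _) = n , toℚᵘ-cancel-≤ (ℚᵘₚ.≤-respʳ-≃ (ℚᵘₚ.≃-sym (toℚᵘ-ι n))
  (ℚᵘ.*≤* (ℤₚ.*-monoˡ-≤-nonNeg (ℤ.+ n) (ℤ.+≤+ (ℕ.s≤s ℕ.z≤n)))))

archimedean : ∀ a {ε} → 0ℚ < ε → ∃[ n ] a < ι (suc n) * ε
archimedean a {ε} 0<ε = n , (begin-strict
  a                     ≡⟨ *-identityʳ a ⟨
  a * 1ℚ                ≡⟨ cong (a *_) (*-inverseˡ ε) ⟨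
  a * (1/ ε * ε)        ≡⟨ *-assoc a (1/ ε) ε ⟨
  a * 1/ ε * ε          ≤⟨ *-monoʳ-≤-nonNeg ε (proj₂ (p≤ι (a * 1/ ε))) ⟩
  ι n * ε               <⟨ *-monoˡ-<-pos ε (subst (_< ι (suc n)) (+-identityˡ (ι n))
                             (+-monoˡ-< (ι n) (positive⁻¹ 1ℚ))) ⟩
  ι (suc n) * ε         ∎)
  where
  open ≤-Reasoning
  instance
    ε-pos : Positive ε
    ε-pos = positive 0<ε
    ε-nonNeg : NonNegative ε
    ε-nonNeg = pos⇒nonNeg ε
    ε-nonZero : NonZero ε
    ε-nonZero = pos⇒nonZero ε
  n : ℕ
  n = proj₁ (p≤ι (a * 1/ ε))

-- Nonnegativity of sums with log-convex coefficients.

record LogConvex (c : ℕ → ℚ) : Set where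
  field
    terms-pos : ∀ i → 0ℚ < c i
    convex    : ∀ i → c (suc i) * c (suc i) ≤ c i * c (suc (suc i))

open LogConvex

tail : ∀ {c} → LogConvex c → LogConvex (c ∘ suc)
tail lc = record { terms-pos = terms-pos lc ∘ suc ; convex = convex lc ∘ suc }

module _ {x : ℚ} (x≤0 : x ≤ 0ℚ) where

  private
    instance
      x-nonPos : NonPositive x
      x-nonPos = nonPositive x≤0

  -- The hypothesis says that |x| c₁ ≥ c₀. The ratios of consecutive coefficients increase, so |x|
  -- c₂ ≥ c₁ follows; multiplying by c₁ > 0 avoids the quotients.
  keeps-rising : ∀ {c} → LogConvex c → c 0 + x * c 1 ≤ 0ℚ → c 1 + x * c 2 ≤ 0ℚ
  keeps-rising {c} lc rise = *-cancelˡ-≤-pos (c 1) (begin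
    c 1 * (c 1 + x * c 2)
      ≡⟨ solve 3 (λ b d x → b :* (b :+ x :* d) := b :* b :+ x :* b :* d) refl (c 1) (c 2) x ⟩
    c 1 * c 1 + x * c 1 * c 2   ≤⟨ +-monoˡ-≤ _ (convex lc 0) ⟩
    c 0 * c 2 + x * c 1 * c 2   ≡⟨ *-distribʳ-+ (c 2) (c 0) (x * c 1) ⟨
    (c 0 + x * c 1) * c 2       ≤⟨ *-monoʳ-≤-nonNeg (c 2) rise ⟩
    0ℚ * c 2                    ≡⟨ *-zeroˡ (c 2) ⟩
    0ℚ                          ≡⟨ *-zeroʳ (c 1) ⟨
    c 1 * 0ℚ                    ∎)
    where
    open ≤-Reasoning
    instance
      c₁-pos : Positive (c 1)
      c₁-pos = positive (terms-pos lc 1)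
      c₂-nonNeg : NonNegative (c 2)
      c₂-nonNeg = nonNegative (<⇒≤ (terms-pos lc 2))

  -- Past the turning point the head stays alone and each later odd term is paired with the larger
  -- even term after it. The bound is `c 0` and not 0 so that the induction hypothesis reads E ≥ c₂,
  -- whence c₁ + x E ≤ c₁ + x c₂ ≤ 0.
  rising-≥-head : ∀ k {c} → LogConvex c → c 0 + x * c 1 ≤ 0ℚ →
    c 0 ≤ evalℚ (applyUpTo c (suc (k ℕ.* 2))) x
  rising-≥-head zero    {c} lc rise = ≤-reflexive (solve 2 (λ a x → a := a :+ x :* con 0ℚ) refl (c 0) x)
  rising-≥-head (suc k) {c} lc rise = begin
    c 0                        ≡⟨ solve 2 (λ a x → a := a :+ x :* con 0ℚ) refl (c 0) x ⟩
    c 0 + x * 0ℚ               ≤⟨ +-monoʳ-≤ (c 0) (*-monoˡ-≤-nonPos x (begin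
      c 1 + x * E                ≤⟨ +-monoʳ-≤ (c 1) (*-monoˡ-≤-nonPos x
                                      (rising-≥-head k (tail (tail lc)) (keeps-rising (tail lc) rise₁))) ⟩
      c 1 + x * c 2              ≤⟨ rise₁ ⟩
      0ℚ                         ∎)) ⟩
    c 0 + x * (c 1 + x * E)    ∎
    where
    open ≤-Reasoning
    E : ℚ
    E = evalℚ (applyUpTo (c ∘ suc ∘ suc) (suc (k ℕ.* 2))) x
    rise₁ : c 1 + x * c 2 ≤ 0ℚ
    rise₁ = keeps-rising lc rise

  eval-nonNeg-≤0 : ∀ k {c} → LogConvex c → 0ℚ ≤ evalℚ (applyUpTo c (suc (k ℕ.* 2))) x
  eval-nonNeg-≤0 zero    {c} lc = ≤-trans (<⇒≤ (terms-pos lc 0))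
    (≤-reflexive (solve 2 (λ a x → a := a :+ x :* con 0ℚ) refl (c 0) x))
  eval-nonNeg-≤0 (suc k) {c} lc with ≤-total (c 0 + x * c 1) 0ℚ
  ... | inj₁ rise = ≤-trans (<⇒≤ (terms-pos lc 0)) (rising-≥-head (suc k) lc rise)
  -- Before the turning point the first two terms form a nonnegative pair, and the rest is x² times
  -- a shorter sum of the same kind.
  ... | inj₂ fall = begin
    0ℚ                            ≤⟨ 0≤+ fall (0≤* (0≤² x) (eval-nonNeg-≤0 k (tail (tail lc)))) ⟩
    (c 0 + x * c 1) + x * x * E
      ≡⟨ solve 4 (λ a b x E → (a :+ x :* b) :+ x :* x :* E := a :+ x :* (b :+ x :* E)) refl (c 0) (c 1) x E ⟩
    c 0 + x * (c 1 + x * E)       ∎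
    where
    open ≤-Reasoning
    E : ℚ
    E = evalℚ (applyUpTo (c ∘ suc ∘ suc) (suc (k ℕ.* 2))) x

eval-nonNeg-≥0 : ∀ n {c x} → LogConvex c → 0ℚ ≤ x → 0ℚ ≤ evalℚ (applyUpTo c n) x
eval-nonNeg-≥0 zero    lc 0≤x = ≤-refl
eval-nonNeg-≥0 (suc n) lc 0≤x = 0≤+ (<⇒≤ (terms-pos lc 0)) (0≤* 0≤x (eval-nonNeg-≥0 n (tail lc) 0≤x))

eval-nonNeg : ∀ k {c} → LogConvex c → ∀ x → 0ℚ ≤ evalℚ (applyUpTo c (suc (k ℕ.* 2))) x
eval-nonNeg k lc x with ≤-total 0ℚ x
... | inj₁ 0≤x = eval-nonNeg-≥0 (suc (k ℕ.* 2)) lc 0≤x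
... | inj₂ x≤0 = eval-nonNeg-≤0 x≤0 k lc

-- The constant coefficient enters additively, so whatever is taken off it while log-convexity
-- survives becomes a lower bound for the polynomial.
eval-≥δ : ∀ k {c} → LogConvex c → ∀ δ x → δ ≤ evalℚ ((δ + c 0) ∷ applyUpTo (c ∘ suc) (k ℕ.* 2)) x
eval-≥δ k {c} lc δ x = begin
  δ                  ≡⟨ +-identityʳ δ ⟨
  δ + 0ℚ             ≤⟨ +-monoʳ-≤ δ (eval-nonNeg k lc x) ⟩
  δ + (c 0 + x * E)  ≡⟨ +-assoc δ (c 0) (x * E) ⟨
  δ + c 0 + x * E    ∎
  where
  open ≤-Reasoning
  E : ℚ
  E = evalℚ (applyUpTo (c ∘ suc) (k ℕ.* 2)) x

-- Lower bounds for p_m and p_m′ on ℚ.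

-- With head h, the first convexity condition is 1 ≤ 4 h for the coefficients h, 1, 4 of p_m and 64
-- ≤ 81 h for the coefficients h, 8, 81 of p_m′. Both hold for h = 7/8.
⅛ ⅞ : ℚ
⅛ = ℤ.+ 1 / 8
⅞ = ℤ.+ 7 / 8

ι-log-convex : ∀ a b c → a ℕ.* a ℕ.≤ b ℕ.* c → ι a * ι a ≤ ι b * ι c
ι-log-convex a b c a²≤bc = begin
  ι a * ι a      ≡⟨ ι-* a a ⟨
  ι (a ℕ.* a)    ≤⟨ ι-mono-≤ a²≤bc ⟩
  ι (b ℕ.* c)    ≡⟨ ι-* b c ⟩
  ι b * ι c      ∎
  where open ≤-Reasoning

coefficient : ℕ → ℚ
coefficient i = ι (i ℕ.^ i)

derivative-coefficient : ℕ → ℚ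
derivative-coefficient j = ι (suc j ℕ.^ suc (suc j))

withHead : ℚ → (ℕ → ℚ) → ℕ → ℚ
withHead a c zero    = a
withHead a c (suc i) = c (suc i)

coefficient-logConvex : LogConvex (withHead ⅞ coefficient)
coefficient-logConvex = record
  { terms-pos = λ where
      zero    → positive⁻¹ ⅞
      (suc i) → 0<ι ((1 ℕ.+ i) ℕ.^ (1 ℕ.+ i)) {{ℕₚ.m^n≢0 (1 ℕ.+ i) (1 ℕ.+ i)}}
  ; convex = λ where
      zero    → ≤ᵇ⇒≤ tt
      (suc i) → ι-log-convex ((2 ℕ.+ i) ℕ.^ (2 ℕ.+ i)) ((1 ℕ.+ i) ℕ.^ (1 ℕ.+ i)) ((3 ℕ.+ i) ℕ.^ (3 ℕ.+ i))
                  (self-power-log-convex (suc i))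
  }

derivative-coefficient-logConvex : LogConvex (withHead ⅞ derivative-coefficient)
derivative-coefficient-logConvex = record
  { terms-pos = λ where
      zero    → positive⁻¹ ⅞
      (suc j) → 0<ι ((2 ℕ.+ j) ℕ.^ (3 ℕ.+ j)) {{ℕₚ.m^n≢0 (2 ℕ.+ j) (3 ℕ.+ j)}}
  ; convex = λ where
      zero    → ≤ᵇ⇒≤ tt
      (suc j) → ι-log-convex ((3 ℕ.+ j) ℕ.^ (4 ℕ.+ j)) ((2 ℕ.+ j) ℕ.^ (3 ℕ.+ j)) ((4 ℕ.+ j) ℕ.^ (5 ℕ.+ j))
                  (^-log-convex (suc j))
  }

pℚ : ℕ → List ℚ
pℚ m = applyUpTo coefficient (suc m)

pℚ-even-≥⅛ : ∀ k x → ⅛ ≤ evalℚ (pℚ (k ℕ.* 2)) x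
-- `⅛ + ⅞` computes to the constant coefficient 1, and `withHead` leaves the others unchanged.
pℚ-even-≥⅛ k = eval-≥δ k coefficient-logConvex ⅛

eval-applyUpTo-cong : ∀ n {b c} x → (∀ i → b i ≡ c i) → evalℚ (applyUpTo b n) x ≡ evalℚ (applyUpTo c n) x
eval-applyUpTo-cong zero    x b≗c = refl
eval-applyUpTo-cong (suc n) x b≗c =
  cong₂ (λ a v → a + x * v) (b≗c 0) (eval-applyUpTo-cong n x (b≗c ∘ suc))

eval-applyUpTo-+ : ∀ n b c x →
  evalℚ (applyUpTo (λ i → b i + c i) n) x ≡ evalℚ (applyUpTo b n) x + evalℚ (applyUpTo c n) x
eval-applyUpTo-+ zero    b c x = refl
eval-applyUpTo-+ (suc n) b c x = trans
  (cong (λ v → b 0 + c 0 + x * v) (eval-applyUpTo-+ n (b ∘ suc) (c ∘ suc) x))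
  (solve 5 (λ b c x u v → b :+ c :+ x :* (u :+ v) := (b :+ x :* u) :+ (c :+ x :* v)) refl
    (b 0) (c 0) x (evalℚ (applyUpTo (b ∘ suc) n) x) (evalℚ (applyUpTo (c ∘ suc) n) x))

-- In the Horner form f + x f′, the first summand contributes one copy of `c (suc j)` in degree j
-- and the second contributes j copies.
eval′-applyUpTo : ∀ m c x →
  eval′ℚ (applyUpTo c (suc m)) x ≡ evalℚ (applyUpTo (λ j → ι (suc j) * c (suc j)) m) x
eval′-applyUpTo zero    c x = trans (+-identityˡ (x * 0ℚ)) (*-zeroʳ x)
eval′-applyUpTo (suc m) c x = begin
  (c 1 + x * U) + x * eval′ℚ (applyUpTo (c ∘ suc) (suc m)) x
    ≡⟨ cong (λ v → (c 1 + x * U) + x * v) (eval′-applyUpTo m (c ∘ suc) x) ⟩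
  (c 1 + x * U) + x * V
    ≡⟨ solve 4 (λ c x u v → (c :+ x :* u) :+ x :* v := con (ι 1) :* c :+ x :* (u :+ v)) refl (c 1) x U V ⟩
  ι 1 * c 1 + x * (U + V)
    ≡⟨ cong (λ v → ι 1 * c 1 + x * v) (eval-applyUpTo-+ m (c ∘ suc ∘ suc) _ x) ⟨
  ι 1 * c 1 + x * evalℚ (applyUpTo (λ j → c (suc (suc j)) + ι (suc j) * c (suc (suc j))) m) x
    ≡⟨ cong (λ v → ι 1 * c 1 + x * v) (eval-applyUpTo-cong m x λ j →
         solve 2 (λ c n → c :+ n :* c := (con 1ℚ :+ n) :* c) refl (c (suc (suc j))) (ι (suc j))) ⟩
  ι 1 * c 1 + x * evalℚ (applyUpTo (λ j → ι (suc (suc j)) * c (suc (suc j))) m) x ∎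
  where
  open ≡-Reasoning
  U V : ℚ
  U = evalℚ (applyUpTo (c ∘ suc ∘ suc) m) x
  V = evalℚ (applyUpTo (λ j → ι (suc j) * c (suc (suc j))) m) x

pℚ′-odd-≥⅛ : ∀ k x → ⅛ ≤ eval′ℚ (pℚ (suc (k ℕ.* 2))) x
pℚ′-odd-≥⅛ k x = begin
  ⅛
    ≤⟨ eval-≥δ k derivative-coefficient-logConvex ⅛ x ⟩
  evalℚ (applyUpTo derivative-coefficient (suc (k ℕ.* 2))) x
    ≡⟨ eval-applyUpTo-cong (suc (k ℕ.* 2)) x (λ j → ι-* (suc j) (suc j ℕ.^ suc j)) ⟩
  evalℚ (applyUpTo (λ j → ι (suc j) * coefficient (suc j)) (suc (k ℕ.* 2))) x
    ≡⟨ eval′-applyUpTo (suc (k ℕ.* 2)) coefficient x ⟨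
  eval′ℚ (pℚ (suc (k ℕ.* 2))) x ∎
  where open ≤-Reasoning

-- Taylor's formula with bounded remainder.

-- The cofactor of (u - v)² in the expansion of f(u) about v, itself a polynomial in u and v.
remainder : List ℚ → ℚ → ℚ → ℚ
remainder []      u v = 0ℚ
remainder (a ∷ f) u v = u * remainder f u v + eval′ℚ f v

taylor : ∀ f u v →
  evalℚ f u - evalℚ f v ≡ eval′ℚ f v * (u - v) + remainder f u v * ((u - v) * (u - v))
taylor []      u v = solve 2 (λ u v → con 0ℚ :- con 0ℚ :=
  con 0ℚ :* (u :- v) :+ con 0ℚ :* ((u :- v) :* (u :- v))) refl u v
taylor (a ∷ f) u v = begin
  (a + u * F u) - (a + v * F v)
    ≡⟨ solve 5 (λ a u v F G → (a :+ u :* F) :- (a :+ v :* G) := u :* (F :- G) :+ (u :- v) :* G)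
         refl a u v (F u) (F v) ⟩
  u * (F u - F v) + (u - v) * F v
    ≡⟨ cong (λ d → u * d + (u - v) * F v) (taylor f u v) ⟩
  u * (F′ * (u - v) + H * ((u - v) * (u - v))) + (u - v) * F v
    ≡⟨ solve 5 (λ u v F F′ H →
         u :* (F′ :* (u :- v) :+ H :* ((u :- v) :* (u :- v))) :+ (u :- v) :* F
           := (F :+ v :* F′) :* (u :- v) :+ (u :* H :+ F′) :* ((u :- v) :* (u :- v)))
         refl u v (F v) F′ H ⟩
  (F v + v * F′) * (u - v) + (u * H + F′) * ((u - v) * (u - v)) ∎
  where
  open ≡-Reasoning
  F : ℚ → ℚ
  F = evalℚ f
  F′ H : ℚ
  F′ = eval′ℚ f v
  H = remainder f u v

-- One Horner step; the three recursions bounded below all have this shape.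
∣a+x*b∣≤ : ∀ {a x b A B C} → ∣ a ∣ ≤ A → ∣ x ∣ ≤ B → ∣ b ∣ ≤ C → ∣ a + x * b ∣ ≤ A + B * C
∣a+x*b∣≤ {a} {x} {b} {A} {B} {C} a≤A x≤B b≤C = begin
  ∣ a + x * b ∣          ≤⟨ ∣p+q∣≤∣p∣+∣q∣ a (x * b) ⟩
  ∣ a ∣ + ∣ x * b ∣      ≡⟨ cong (∣ a ∣ +_) (∣p*q∣≡∣p∣*∣q∣ x b) ⟩
  ∣ a ∣ + ∣ x ∣ * ∣ b ∣  ≤⟨ +-mono-≤ a≤A (≤-trans
                              (*-monoʳ-≤-nonNeg ∣ b ∣ {{∣-∣-nonNeg b}} x≤B)
                              (*-monoˡ-≤-nonNeg B {{nonNegative (≤-trans (0≤∣p∣ x) x≤B)}} b≤C)) ⟩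
  A + B * C              ∎
  where open ≤-Reasoning

module _ (B : ℚ) where

  eval-bounded : ∀ f → ∃[ K ] ∀ x → ∣ x ∣ ≤ B → ∣ evalℚ f x ∣ ≤ K
  eval-bounded []      = 0ℚ , λ _ _ → ≤-refl
  eval-bounded (a ∷ f) =
    let K , b = eval-bounded f
    in ∣ a ∣ + B * K , λ x x≤B → ∣a+x*b∣≤ {a} {x} ≤-refl x≤B (b x x≤B)

  eval′-bounded : ∀ f → ∃[ K ] ∀ x → ∣ x ∣ ≤ B → ∣ eval′ℚ f x ∣ ≤ K
  eval′-bounded []      = 0ℚ , λ _ _ → ≤-refl
  eval′-bounded (a ∷ f) =
    let K , b = eval-bounded f
        L , d = eval′-bounded f
    in K + B * L , λ x x≤B → ∣a+x*b∣≤ {evalℚ f x} {x} (b x x≤B) x≤B (d x x≤B)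

  -- The bound is uniform in u and v because it has to serve every subinterval that repeated halving
  -- produces.
  remainder-bounded : ∀ f → ∃[ K ] ∀ u v → ∣ u ∣ ≤ B → ∣ v ∣ ≤ B → ∣ remainder f u v ∣ ≤ K
  remainder-bounded []      = 0ℚ , λ _ _ _ _ → ≤-refl
  remainder-bounded (a ∷ f) =
    let K , b = eval′-bounded f
        L , d = remainder-bounded f
    in K + B * L , λ u v u≤B v≤B → subst (λ w → ∣ w ∣ ≤ K + B * L)
         (+-comm (eval′ℚ f v) (u * remainder f u v))
         (∣a+x*b∣≤ {eval′ℚ f v} {u} (b v v≤B) u≤B (d u v u≤B v≤B))

-- Repeated halving and midpoints.

-- This is a / 2^k, with the halvings accumulated in the argument to follow the recursion of
-- `almostIncreasing-halve`.
halve : ℕ → ℚ → ℚ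
halve zero    a = a
halve (suc k) a = halve k (½ * a)

halve-* : ∀ k a b → halve k a * b ≡ halve k (a * b)
halve-* zero    a b = refl
halve-* (suc k) a b = trans (halve-* k (½ * a) b) (cong (halve k) (*-assoc ½ a b))

-- Rests on k + 1 ≤ 2^k: one halving turns the factor k + 2 into (k + 2) / 2, which falls short of k
-- + 1 by k / 2.
halve-small : ∀ k {a ε} → 0ℚ ≤ ε → a < ι (suc k) * ε → halve k a < ε
halve-small zero    {a} {ε} 0≤ε a<ε = subst (a <_) (*-identityˡ ε) a<ε
halve-small (suc k) {a} {ε} 0≤ε a<[2+k]ε = halve-small k 0≤ε (begin-strict
  ½ * a                              <⟨ *-monoʳ-<-pos ½ a<[2+k]ε ⟩
  ½ * (ι (2 ℕ.+ k) * ε)              ≡⟨ +-identityʳ _ ⟨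
  ½ * (ι (2 ℕ.+ k) * ε) + 0ℚ         ≤⟨ +-monoʳ-≤ (½ * (ι (2 ℕ.+ k) * ε)) (0≤* (nonNegative⁻¹ ½) (0≤* (0≤ι k) 0≤ε)) ⟩
  ½ * (ι (2 ℕ.+ k) * ε) + ½ * (ι k * ε)
    ≡⟨ solve 2 (λ n ε → con ½ :* ((con 1ℚ :+ (con 1ℚ :+ n)) :* ε) :+ con ½ :* (n :* ε)
                  := (con 1ℚ :+ n) :* ε) refl (ι k) ε ⟩
  ι (suc k) * ε                      ∎)
  where open ≤-Reasoning

halve→0 : ∀ a {ε} → 0ℚ < ε → ∃[ k ] halve k a < ε
halve→0 a 0<ε = let k , a<[1+k]ε = archimedean a 0<ε in k , halve-small k (<⇒≤ 0<ε) a<[1+k]ε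

midpoint : ℚ → ℚ → ℚ
midpoint u v = ½ * (u + v)

midpoint-≤ : ∀ {u v} → u ≤ v → u ≤ midpoint u v
midpoint-≤ {u} {v} u≤v = 0≤q-p⇒p≤q (subst (0ℚ ≤_)
  (solve 2 (λ u v → con ½ :* (v :- u) := con ½ :* (u :+ v) :- u) refl u v)
  (0≤* (nonNegative⁻¹ ½) (p≤q⇒0≤q-p u≤v)))

midpoint-≥ : ∀ {u v} → u ≤ v → midpoint u v ≤ v
midpoint-≥ {u} {v} u≤v = 0≤q-p⇒p≤q (subst (0ℚ ≤_)
  (solve 2 (λ u v → con ½ :* (v :- u) := v :- con ½ :* (u :+ v)) refl u v)
  (0≤* (nonNegative⁻¹ ½) (p≤q⇒0≤q-p u≤v)))

∣midpoint∣≤ : ∀ {u v B} → ∣ u ∣ ≤ B → ∣ v ∣ ≤ B → ∣ midpoint u v ∣ ≤ B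
∣midpoint∣≤ {u} {v} {B} u≤B v≤B = begin
  ∣ ½ * (u + v) ∣          ≡⟨ ∣p*q∣≡∣p∣*∣q∣ ½ (u + v) ⟩
  ½ * ∣ u + v ∣            ≤⟨ *-monoˡ-≤-nonNeg ½ (≤-trans (∣p+q∣≤∣p∣+∣q∣ u v) (+-mono-≤ u≤B v≤B)) ⟩
  ½ * (B + B)              ≡⟨ solve 1 (λ B → con ½ :* (B :+ B) := B) refl B ⟩
  B                        ∎
  where open ≤-Reasoning

-- The mean value inequality on ℚ.

module _ (f : List ℚ) (s : ℚ) (s≤f′ : ∀ x → s ≤ eval′ℚ f x) where

  -- The mean value inequality on [-B, B] up to a quadratic error. Taylor's formula provides it for
  -- some t, and bisecting intervals makes t arbitrarily small.
  AlmostIncreasing : ℚ → ℚ → Set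
  AlmostIncreasing B t = ∀ u v → ∣ u ∣ ≤ B → ∣ v ∣ ≤ B → v ≤ u →
    s * (u - v) ≤ (evalℚ f u - evalℚ f v) + t * ((u - v) * (u - v))

  almostIncreasing-remainder : ∀ B → AlmostIncreasing B (proj₁ (remainder-bounded B f))
  almostIncreasing-remainder B u v u≤B v≤B v≤u = begin
    s * d                          ≤⟨ *-monoʳ-≤-nonNeg d {{nonNegative (p≤q⇒0≤q-p v≤u)}} (s≤f′ v) ⟩
    F′ * d                         ≡⟨ +-identityʳ _ ⟨
    F′ * d + 0ℚ                    ≤⟨ +-monoʳ-≤ (F′ * d) (0≤* 0≤K+H (0≤² d)) ⟩
    F′ * d + (K - (- H)) * (d * d)
      ≡⟨ solve 4 (λ F d K H → F :* d :+ (K :- (:- H)) :* (d :* d)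
                    := (F :* d :+ H :* (d :* d)) :+ K :* (d :* d)) refl F′ d K H ⟩
    (F′ * d + H * (d * d)) + K * (d * d)
      ≡⟨ cong (_+ K * (d * d)) (taylor f u v) ⟨
    (evalℚ f u - evalℚ f v) + K * (d * d) ∎
    where
    open ≤-Reasoning
    d F′ H K : ℚ
    d = u - v
    F′ = eval′ℚ f v
    H = remainder f u v
    K = proj₁ (remainder-bounded B f)
    0≤K+H : 0ℚ ≤ K - (- H)
    0≤K+H = p≤q⇒0≤q-p (≤-trans (-p≤∣p∣ H) (proj₂ (remainder-bounded B f) u v u≤B v≤B))

  -- Applied on both halves of [v, u], the quadratic error is halved.
  almostIncreasing-½ : ∀ {B} t → AlmostIncreasing B t → AlmostIncreasing B (½ * t)
  almostIncreasing-½ t inc u v u≤B v≤B v≤u = begin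
    s * (u - v)
      ≡⟨ solve 4 (λ s u v w → s :* (u :- v) := s :* (u :- w) :+ s :* (w :- v)) refl s u v w ⟩
    s * (u - w) + s * (w - v)
      ≤⟨ +-mono-≤ (inc u w u≤B w≤B (midpoint-≥ v≤u)) (inc w v w≤B v≤B (midpoint-≤ v≤u)) ⟩
    ((F u - F w) + t * ((u - w) * (u - w))) + ((F w - F v) + t * ((w - v) * (w - v)))
      ≡⟨ solve 6 (λ Fu Fw Fv t u v → let w = con ½ :* (v :+ u) in
           ((Fu :- Fw) :+ t :* ((u :- w) :* (u :- w))) :+ ((Fw :- Fv) :+ t :* ((w :- v) :* (w :- v)))
             := (Fu :- Fv) :+ con ½ :* t :* ((u :- v) :* (u :- v))) refl (F u) (F w) (F v) t u v ⟩
    (F u - F v) + ½ * t * ((u - v) * (u - v)) ∎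
    where
    open ≤-Reasoning
    F : ℚ → ℚ
    F = evalℚ f
    w : ℚ
    w = midpoint v u
    w≤B = ∣midpoint∣≤ {v} {u} v≤B u≤B

  almostIncreasing-halve : ∀ k {B} t → AlmostIncreasing B t → AlmostIncreasing B (halve k t)
  almostIncreasing-halve zero    t inc = inc
  almostIncreasing-halve (suc k) t inc = almostIncreasing-halve k (½ * t) (almostIncreasing-½ t inc)

  -- The intermediate point of the mean value theorem need not be rational, so the argument is by
  -- contradiction: a positive `excess` would be at most K d² / 2^k for every k.
  mean-value : ∀ {u v} → v ≤ u → s * (u - v) ≤ evalℚ f u - evalℚ f v
  mean-value {u} {v} v≤u with s * (u - v) ≤? evalℚ f u - evalℚ f v
  ... | yes s*d≤F = s*d≤F
  ... | no  s*d≰F = contradiction (≤-<-trans excess≤ halved<) (<-irrefl refl)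
    where
    B K d D excess : ℚ
    B = ∣ u ∣ + ∣ v ∣
    K = proj₁ (remainder-bounded B f)
    d = u - v
    D = evalℚ f u - evalℚ f v
    excess = s * d - D
    u≤B : ∣ u ∣ ≤ B
    u≤B = subst (_≤ B) (+-identityʳ ∣ u ∣) (+-monoʳ-≤ ∣ u ∣ (0≤∣p∣ v))
    v≤B : ∣ v ∣ ≤ B
    v≤B = subst (_≤ B) (+-identityˡ ∣ v ∣) (+-monoˡ-≤ ∣ v ∣ (0≤∣p∣ u))
    halved : ∃[ k ] halve k (K * (d * d)) < excess
    halved = halve→0 (K * (d * d)) (p<q⇒0<q-p (≰⇒> s*d≰F))
    k : ℕ
    k = proj₁ halved
    halved< : halve k (K * (d * d)) < excess
    halved< = proj₂ halved
    excess≤ : excess ≤ halve k (K * (d * d))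
    excess≤ = begin
      s * d - D
        ≤⟨ +-monoˡ-≤ (- D) (almostIncreasing-halve k K (almostIncreasing-remainder B) u v u≤B v≤B v≤u) ⟩
      (D + halve k K * (d * d)) - D
        ≡⟨ solve 2 (λ D t → (D :+ t) :- D := t) refl D (halve k K * (d * d)) ⟩
      halve k K * (d * d)  ≡⟨ halve-* k K (d * d) ⟩
      halve k (K * (d * d)) ∎
      where open ≤-Reasoning

  ∣mean-value∣ : ∀ u v → s * ∣ u - v ∣ ≤ ∣ evalℚ f u - evalℚ f v ∣
  ∣mean-value∣ u v with ≤-total v u
  ... | inj₁ v≤u = begin
    s * ∣ u - v ∣           ≡⟨ cong (s *_) (0≤p⇒∣p∣≡p (p≤q⇒0≤q-p v≤u)) ⟩
    s * (u - v)             ≤⟨ mean-value v≤u ⟩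
    evalℚ f u - evalℚ f v     ≤⟨ p≤∣p∣ _ ⟩
    ∣ evalℚ f u - evalℚ f v ∣ ∎
    where open ≤-Reasoning
  ... | inj₂ u≤v = begin
    s * ∣ u - v ∣           ≡⟨ cong (s *_) (∣p-q∣≡∣q-p∣ u v) ⟩
    s * ∣ v - u ∣           ≡⟨ cong (s *_) (0≤p⇒∣p∣≡p (p≤q⇒0≤q-p u≤v)) ⟩
    s * (v - u)             ≤⟨ mean-value u≤v ⟩
    evalℚ f v - evalℚ f u     ≤⟨ p≤∣p∣ _ ⟩
    ∣ evalℚ f v - evalℚ f u ∣ ≡⟨ ∣p-q∣≡∣q-p∣ (evalℚ f v) (evalℚ f u) ⟩
    ∣ evalℚ f u - evalℚ f v ∣ ∎
    where open ≤-Reasoning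

-- Bisection of a sign change.

module Bisection (f : ℚ → ℚ) where

  record Bracket : Set where
    field
      lo hi : ℚ
      lo≤hi : lo ≤ hi
      f-lo  : f lo ≤ 0ℚ
      f-hi  : 0ℚ ≤ f hi

  open Bracket public

  width : Bracket → ℚ
  width b = hi b - lo b

  record _Halves_ (b′ b : Bracket) : Set where
    field
      lo-≤    : lo b ≤ lo b′
      hi-≤    : hi b′ ≤ hi b
      width-½ : width b′ ≡ ½ * width b

  open _Halves_

  bisect : ∀ b → ∃[ b′ ] b′ Halves b
  bisect b with ≤-total 0ℚ (f (midpoint (lo b) (hi b)))
  ... | inj₁ 0≤fm = record
    { lo = lo b ; hi = midpoint (lo b) (hi b)
    ; lo≤hi = midpoint-≤ (lo≤hi b) ; f-lo = f-lo b ; f-hi = 0≤fm } , record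
    { lo-≤ = ≤-refl ; hi-≤ = midpoint-≥ (lo≤hi b)
    ; width-½ = solve 2 (λ l h → con ½ :* (l :+ h) :- l := con ½ :* (h :- l)) refl (lo b) (hi b) }
  ... | inj₂ fm≤0 = record
    { lo = midpoint (lo b) (hi b) ; hi = hi b
    ; lo≤hi = midpoint-≥ (lo≤hi b) ; f-lo = fm≤0 ; f-hi = f-hi b } , record
    { lo-≤ = midpoint-≤ (lo≤hi b) ; hi-≤ = ≤-refl
    ; width-½ = solve 2 (λ l h → h :- con ½ :* (l :+ h) := con ½ :* (h :- l)) refl (lo b) (hi b) }

  module Sequence (b₀ : Bracket) where

    bracket : ℕ → Bracket
    bracket zero    = b₀
    bracket (suc n) = proj₁ (bisect (bracket n))

    halves : ∀ n → bracket (suc n) Halves bracket n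
    halves n = proj₂ (bisect (bracket n))

    lo-mono : ∀ {m n} → m ℕ.≤′ n → lo (bracket m) ≤ lo (bracket n)
    lo-mono ℕ.≤′-refl                  = ≤-refl
    lo-mono {n = suc n} (ℕ.≤′-step m≤n) = ≤-trans (lo-mono m≤n) (lo-≤ (halves n))

    hi-antimono : ∀ {m n} → m ℕ.≤′ n → hi (bracket n) ≤ hi (bracket m)
    hi-antimono ℕ.≤′-refl                  = ≤-refl
    hi-antimono {n = suc n} (ℕ.≤′-step m≤n) = ≤-trans (hi-≤ (halves n)) (hi-antimono m≤n)

    width-bracket : ∀ n → width (bracket n) ≡ halve n (width b₀)
    width-bracket zero    = refl
    width-bracket (suc n) = begin
      width (bracket (suc n))      ≡⟨ width-½ (halves n) ⟩
      ½ * width (bracket n)        ≡⟨ cong (½ *_) (width-bracket n) ⟩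
      ½ * halve n (width b₀)       ≡⟨ *-comm ½ (halve n (width b₀)) ⟩
      halve n (width b₀) * ½       ≡⟨ halve-* n (width b₀) ½ ⟩
      halve n (width b₀ * ½)       ≡⟨ cong (halve n) (*-comm (width b₀) ½) ⟩
      halve n (½ * width b₀)       ∎
      where open ≡-Reasoning

    _∈[_] : ℚ → ℕ → Set
    x ∈[ n ] = lo (bracket n) ≤ x × x ≤ hi (bracket n)

    ∈-antimono : ∀ {x m n} → m ℕ.≤ n → x ∈[ n ] → x ∈[ m ]
    ∈-antimono m≤n (lo≤x , x≤hi) =
      ≤-trans (lo-mono (ℕₚ.≤⇒≤′ m≤n)) lo≤x , ≤-trans x≤hi (hi-antimono (ℕₚ.≤⇒≤′ m≤n))

    ∈-close : ∀ {x y} n → x ∈[ n ] → y ∈[ n ] → ∣ x - y ∣ ≤ width (bracket n)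
    ∈-close {x} {y} n (lo≤x , x≤hi) (lo≤y , y≤hi) = ∣p∣≤
      (+-mono-≤ x≤hi (neg-antimono-≤ lo≤y))
      (subst (_≤ width (bracket n)) (solve 2 (λ x y → y :- x := :- (x :- y)) refl x y)
        (+-mono-≤ y≤hi (neg-antimono-≤ lo≤x)))

    ∈-small : ∀ {ε} → 0ℚ < ε → ∃[ N ] ∀ {x y} → x ∈[ N ] → y ∈[ N ] → ∣ x - y ∣ < ε
    ∈-small {ε} 0<ε =
      let N , w<ε = halve→0 (width b₀) 0<ε
      in N , λ x∈ y∈ → ≤-<-trans (∈-close N x∈ y∈) (subst (_< ε) (sym (width-bracket N)) w<ε)

    lo∈ : ∀ n → lo (bracket n) ∈[ n ]
    lo∈ n = ≤-refl , lo≤hi (bracket n)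

    hi∈ : ∀ n → hi (bracket n) ∈[ n ]
    hi∈ n = lo≤hi (bracket n) , ≤-refl

    enclosed-cauchy : ∀ s → (∀ n → s n ∈[ n ]) → IsCauchy s
    enclosed-cauchy s s∈ ε 0<ε =
      let N , small = ∈-small 0<ε
      in N , λ m n N≤m N≤n → small (∈-antimono N≤m (s∈ m)) (∈-antimono N≤n (s∈ n))

    -- Both end points are kept: f is nonpositive along one sequence and nonnegative along the
    -- other, as `squeezed-root` requires.
    lower upper : ℝ
    lower = mkℝ (λ n → lo (bracket n)) (enclosed-cauchy _ lo∈)
    upper = mkℝ (λ n → hi (bracket n)) (enclosed-cauchy _ hi∈)

    lower≃upper : lower ≃ upper
    lower≃upper = mk≃ λ ε 0<ε →
      let N , small = ∈-small 0<ε
      in N , λ n N≤n → small (∈-antimono N≤n (lo∈ n)) (∈-antimono N≤n (hi∈ n))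

-- Transfer from ℚ to ℝ.

liftₚ : List ℚ → Poly
liftₚ = map fromℚ

-- Arithmetic in ℝ is termwise, so a rational polynomial at a real argument is a sequence of
-- rational values, to which the estimates on ℚ apply.
seq-eval : ∀ f x n → seq (eval (liftₚ f) x) n ≡ evalℚ f (seq x n)
seq-eval []      x n = refl
seq-eval (a ∷ f) x n = cong (λ v → a + seq x n * v) (seq-eval f x n)

seq-eval′ : ∀ f x n → seq (ℝ[X].eval′ (liftₚ f) x) n ≡ eval′ℚ f (seq x n)
seq-eval′ []      x n = refl
seq-eval′ (a ∷ f) x n = cong₂ (λ u v → u + seq x n * v) (seq-eval f x n) (seq-eval′ f x n)

bounded-away : ∀ x {δ} → 0ℚ < δ → (∀ n → δ ≤ seq x n) → ¬ (x ≃ 0ℝ)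
bounded-away x {δ} 0<δ δ≤x x≃0 =
  let N , small = close x≃0 δ 0<δ
  in <-irrefl refl (≤-<-trans (≤-trans (δ≤x N) (p≤∣p∣ (seq x N)))
       (subst (λ t → ∣ t ∣ < δ) (+-identityʳ (seq x N)) (small N ℕₚ.≤-refl)))

-- The left side is written `a - 0ℚ` because this is the distance to `0ℝ` in `IsRoot`.
∣-∣≤-across-0 : ∀ {a b} → a ≤ 0ℚ → 0ℚ ≤ b → ∣ a - 0ℚ ∣ ≤ ∣ a - b ∣
∣-∣≤-across-0 {a} {b} a≤0 0≤b = ∣p∣≤
  (≤-trans (subst (_≤ 0ℚ) (sym (+-identityʳ a)) a≤0) (0≤∣p∣ (a - b)))
  (≤-trans (neg-antimono-≤ (+-monoʳ-≤ a (neg-antimono-≤ 0≤b))) (-p≤∣p∣ (a - b)))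

-- Continuity enters through `eval-congʳ`: the values at x and y differ by a null sequence, and 0
-- lies between them term by term.
squeezed-root : ∀ f {x y} → x ≃ y →
  (∀ n → evalℚ f (seq x n) ≤ 0ℚ) → (∀ n → 0ℚ ≤ evalℚ f (seq y n)) → IsRoot (liftₚ f) x
squeezed-root f {x} {y} x≃y fx≤0 0≤fy = mk≃ λ ε 0<ε →
  let N , small = close (ℝ[X].eval-congʳ (liftₚ f) x≃y) ε 0<ε
  in N , λ n N≤n → ≤-<-trans (∣-∣≤-across-0 (fx≤0′ n) (0≤fy′ n)) (small n N≤n)
  where
  fx≤0′ : ∀ n → seq (eval (liftₚ f) x) n ≤ 0ℚ
  fx≤0′ n = subst (_≤ 0ℚ) (sym (seq-eval f x n)) (fx≤0 n)
  0≤fy′ : ∀ n → 0ℚ ≤ seq (eval (liftₚ f) y) n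
  0≤fy′ n = subst (0ℚ ≤_) (sym (seq-eval f y n)) (0≤fy n)

bisection-root : ∀ f → Bisection.Bracket (evalℚ f) → ∃[ r ] IsRoot (liftₚ f) r
bisection-root f b₀ = lower
  , squeezed-root f {lower} {upper} lower≃upper (λ n → f-lo (bracket n)) (λ n → f-hi (bracket n))
  where
  open Bisection (evalℚ f) using (f-lo; f-hi)
  open Bisection.Sequence (evalℚ f) b₀ using (bracket; lower; upper; lower≃upper)

-- The values at two roots differ by a null sequence, which dominates s times the distance of the
-- arguments; hence the tolerance `s * ε`.
root-unique : ∀ f {s} → 0ℚ < s → (∀ x → s ≤ eval′ℚ f x) →
  ∀ {x y} → IsRoot (liftₚ f) x → IsRoot (liftₚ f) y → x ≃ y
root-unique f {s} 0<s s≤f′ {x} {y} x-root y-root = mk≃ λ ε 0<ε →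
  let N , small = close (≃-trans x-root (≃-sym y-root)) (s * ε) (0<s*ε ε 0<ε)
  in N , λ n N≤n → *-cancelˡ-<-nonNeg s {{nonNegative (<⇒≤ 0<s)}}
       (≤-<-trans (∣mean-value∣ f s s≤f′ (seq x n) (seq y n))
         (subst (_< s * ε) (cong₂ (λ u v → ∣ u - v ∣) (seq-eval f x n) (seq-eval f y n)) (small n N≤n)))
  where
  0<s*ε : ∀ ε → 0ℚ < ε → 0ℚ < s * ε
  0<s*ε ε 0<ε = positive⁻¹ (s * ε) {{pos*pos⇒pos s {{positive 0<s}} ε {{positive 0<ε}}}}

-- Rational coefficients of p_m, and the even case.

seq-·1 : ∀ i n → seq (i ℝ[X].·1) n ≡ ι i
seq-·1 zero    n = refl
seq-·1 (suc i) n = cong (λ t → 1ℚ + t) (seq-·1 i n)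

applyUpTo≈liftₚ : ∀ m c d → (∀ i → c i ≃ fromℚ (d i)) → applyUpTo c m ≈ₚ liftₚ (applyUpTo d m)
applyUpTo≈liftₚ zero    c d c≃d j       = ≃-refl {0ℝ}
applyUpTo≈liftₚ (suc m) c d c≃d zero    = c≃d 0
applyUpTo≈liftₚ (suc m) c d c≃d (suc j) = applyUpTo≈liftₚ m (c ∘ suc) (d ∘ suc) (c≃d ∘ suc) j

p≡pᴿ : ∀ m → p m ≡ ℝ[X].pᴿ m
p≡pᴿ zero    = refl
p≡pᴿ (suc m) = cong (_+ₚ (suc m · X) ^ suc m) (p≡pᴿ m)

p≈pℚ : ∀ m → p m ≈ₚ liftₚ (pℚ m)
p≈pℚ m j = ≃-trans {coeff (p m) j} {coeff (applyUpTo ℝ[X].selfPower (suc m)) j} {coeff (liftₚ (pℚ m)) j}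
  (subst (λ f → coeff f j ≃ coeff (applyUpTo ℝ[X].selfPower (suc m)) j) (sym (p≡pᴿ m))
    (ℝ[X].pᴿ≈applyUpTo m j))
  (applyUpTo≈liftₚ (suc m) ℝ[X].selfPower coefficient (λ i → pointwise (seq-·1 (i ℕ.^ i))) j)

root-of-pℚ : ∀ m {x} → IsRoot (p m) x → IsRoot (liftₚ (pℚ m)) x
root-of-pℚ m {x} = ≃-trans (≃-sym (ℝ[X].eval-cong (p m) (liftₚ (pℚ m)) x (p≈pℚ m)))

p-even : ∀ k x → ¬ IsRoot (p (k ℕ.* 2)) x
p-even k x root = bounded-away (eval (liftₚ (pℚ (k ℕ.* 2))) x) (positive⁻¹ ⅛)
  (λ n → subst (⅛ ≤_) (sym (seq-eval (pℚ (k ℕ.* 2)) x n)) (pℚ-even-≥⅛ k (seq x n)))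
  (root-of-pℚ (k ℕ.* 2) {x} root)

-- The odd case: existence, uniqueness and simplicity of the root.

module _ (m : ℕ) (p′≥⅛ : ∀ x → ⅛ ≤ eval′ℚ (pℚ m) x) where

  private
    f : List ℚ
    f = pℚ m
    q₀ : ℚ
    q₀ = - (ℤ.+ 8 / 1)

  f[0]≡1 : evalℚ f 0ℚ ≡ 1ℚ
  f[0]≡1 = trans (cong (λ t → 1ℚ + t) (*-zeroˡ (evalℚ (applyUpTo (coefficient ∘ suc) m) 0ℚ))) (+-identityʳ 1ℚ)

  -- p_m(-8) ≤ p_m(0) - 8 · ⅛ = 0
  f[q₀]≤0 : evalℚ f q₀ ≤ 0ℚ
  f[q₀]≤0 = 0≤q-p⇒p≤q (begin
    0ℚ                               ≤⟨ p≤q⇒0≤q-p (mean-value f ⅛ p′≥⅛ {0ℚ} {q₀} (≤ᵇ⇒≤ tt)) ⟩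
    (evalℚ f 0ℚ - evalℚ f q₀) - 1ℚ   ≡⟨ cong (λ t → (t - evalℚ f q₀) - 1ℚ) f[0]≡1 ⟩
    (1ℚ - evalℚ f q₀) - 1ℚ
      ≡⟨ solve 1 (λ t → (con 1ℚ :- t) :- con 1ℚ := con 0ℚ :- t) refl (evalℚ f q₀) ⟩
    0ℚ - evalℚ f q₀                  ∎)
    where open ≤-Reasoning

  increasing-root : ∃[ r ] IsRoot (liftₚ f) r
  increasing-root = bisection-root f record
    { lo = q₀ ; hi = 0ℚ ; lo≤hi = ≤ᵇ⇒≤ tt ; f-lo = f[q₀]≤0
    ; f-hi = subst (0ℚ ≤_) (sym f[0]≡1) (nonNegative⁻¹ 1ℚ) }

  -- A double root would be a zero of the derivative, but the derivative is at least `⅛` at every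
  -- term of the sequence of r.
  no-double-root : ∀ r → (X- r) ^ 2 ∤ p m
  no-double-root r double = bounded-away (ℝ[X].eval′ (liftₚ f) r) (positive⁻¹ ⅛)
    (λ n → subst (⅛ ≤_) (sym (seq-eval′ f r n)) (p′≥⅛ (seq r n)))
    (≃-trans {ℝ[X].eval′ (liftₚ f) r} {ℝ[X].eval′ (p m) r} {0ℝ}
      (≃-sym {ℝ[X].eval′ (p m) r} {ℝ[X].eval′ (liftₚ f) r} (ℝ[X].eval′-cong (p m) (liftₚ f) r (p≈pℚ m)))
      (ℝ[X].double-root (p m) r double))

  root-of-p : ∀ r → IsRoot (liftₚ f) r → IsRoot (p m) r
  root-of-p r = ≃-trans {eval (p m) r} {eval (liftₚ f) r} {0ℝ}
    (ℝ[X].eval-cong (p m) (liftₚ f) r (p≈pℚ m))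

  only-root : ∀ r → IsRoot (liftₚ f) r → ∀ x → IsRoot (p m) x → x ≃ r
  only-root r fr≃0 x px≃0 = root-unique f (positive⁻¹ ⅛) p′≥⅛ {x} {r} (root-of-pℚ m {x} px≃0) fr≃0

  exactlyOneRoot : (r : ℝ) → IsRoot (liftₚ f) r → ExactlyOneRootCountedWithMultiplicity (p m)
  exactlyOneRoot r fr≃0 = r , root-of-p r fr≃0 , only-root r fr≃0
    , ℝ[X].factor-theorem r (p m) (root-of-p r fr≃0) , no-double-root r

  increasing⇒exactlyOneRoot : ExactlyOneRootCountedWithMultiplicity (p m)
  increasing⇒exactlyOneRoot = exactlyOneRoot (proj₁ increasing-root) (proj₂ increasing-root)

-- Combining the two parities.

even⊎odd : ∀ m → 2 ∣ℕ m ⊎ ∃[ k ] m ≡ suc (k ℕ.* 2)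
even⊎odd zero    = inj₁ (divides 0 refl)
even⊎odd (suc m) with even⊎odd m
... | inj₁ (divides k eq) = inj₂ (k , cong suc eq)
... | inj₂ (k , eq)       = inj₁ (divides (suc k) (cong suc eq))

theorem8p4 : ∀ (m : ℕ) →
    (2 ∣ℕ m → ∀ (x : ℝ) → ¬ IsRoot (p m) x) ×
    (2 ∤ℕ m → ExactlyOneRootCountedWithMultiplicity (p m))
theorem8p4 m = even , odd (even⊎odd m)
  where
  even : 2 ∣ℕ m → ∀ (x : ℝ) → ¬ IsRoot (p m) x
  even (divides k m≡2k) = subst (λ m → ∀ x → ¬ IsRoot (p m) x) (sym m≡2k) (p-even k)
  odd : 2 ∣ℕ m ⊎ ∃[ k ] m ≡ suc (k ℕ.* 2) → 2 ∤ℕ m → ExactlyOneRootCountedWithMultiplicity (p m)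
  odd (inj₁ 2∣m)          2∤m = contradiction 2∣m 2∤m
  odd (inj₂ (k , m≡1+2k)) _   = subst (λ m → ExactlyOneRootCountedWithMultiplicity (p m)) (sym m≡1+2k)
    (increasing⇒exactlyOneRoot (suc (k ℕ.* 2)) (pℚ′-odd-≥⅛ k))
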